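{- For every multibroom $T$ and every integer $k\ge 1$, there exists $c>1$ such that $\chi^*(G)\le c$ for every $\{T,K_{k+1}\}$-free graph $G$.
   Context: Graphs are finite, with no loops or parallel edges. A graph is $\{T,K_{k+1}\}$-free if it has no induced subgraph isomorphic to $T$ and none isomorphic to $K_{k+1}$. A broom is a tree obtained from a path with vertices $v_0,v_1,\ldots,v_\ell$ in order (where $\ell\ge 1$) by adding some number (possibly zero) of new vertices, each adjacent to $v_\ell$ only; $v_0$ is its root and $\ell$ its length. A multibroom is a graph obtained from finitely many vertex-disjoint brooms (of lengths $\ell_1,\ldots,\ell_n\ge 1$) by identifying their roots into a single vertex. For integers $a,b\ge 1$, an $(a,b)$-fractional colouring of $G$ is a family $(A_i:1\le i\le a)$ of stable (independent) sets of $G$ such that $|\{i\in\{1,\ldots,a\}:v\in A_i\}|\ge b$ for each vertex $v$. The fractional chromatic number $\chi^*(G)$ is the minimum of $a/b$ over all pairs $a,b$ such that $G$ admits an $(a,b)$-fractional colouring. -}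

module Defs where

open import Data.Fin using (Fin; zero; suc; inject₁; fromℕ)
open import Data.Fin.Properties using (suc-injective)
open import Data.Fin.Subset using (Subset; _∈_; ∣_∣)
open import Data.Integer using (+_)
open import Data.Nat using (ℕ; suc; NonZero; _≤_)
open import Data.Product using (_×_; _,_; ∃-syntax; Σ-syntax)
open import Data.Rational as ℚ using (ℚ)
open import Data.Vec using (lookup; tabulate)
open import Function.Bundles using (_⇔_; _↔_; _↣_; Inverse; Injection)
open import Level using (0ℓ)
open import Relation.Binary.Core using (Rel)
open import Relation.Binary.Definitions using (Symmetric; Irreflexive; Decidable)
open import Relation.Binary.Construct.Closure.Symmetric using (SymClosure; fwd; bwd; symmetric)
open import Relation.Binary.PropositionalEquality using (_≡_; _≢_; refl; sym; ≢-sym)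
open import Relation.Nullary using (¬_)

record Graph (V : Set) : Set₁ where
  field
    _~_    : Rel V 0ℓ
    ~-sym  : Symmetric _~_
    ~-irr  : Irreflexive _≡_ _~_

-- Every finite graph is, up to isomorphism, a graph on some Fin n.
-- Decidability of adjacency is automatic classically.
record FiniteGraph : Set₁ where
  field
    order : ℕ
    graph : Graph (Fin order)
  open Graph graph public
  field
    _~?_  : Decidable _~_

open FiniteGraph using (order; graph)

record _≅_ {V W : Set} (G : Graph V) (H : Graph W) : Set where
  private
    module G = Graph G
    module H = Graph H
  field
    vertices : V ↔ W
  open Inverse vertices using (to)
  field
    edges : ∀ u v → u G.~ v ⇔ to u H.~ to v

-- An induced subgraph of G isomorphic to H: the image of an injection under
-- which both adjacency and non-adjacency are preserved.
record InducedCopy {V W : Set} (H : Graph V) (G : Graph W) : Set where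
  private
    module H = Graph H
    module G = Graph G
  field
    vertices : V ↣ W
  open Injection vertices using (to)
  field
    edges : ∀ u v → u H.~ v ⇔ to u G.~ to v

_-free_ : {V W : Set} → Graph V → Graph W → Set
H -free G = ¬ InducedCopy H G

complete : ∀ n → Graph (Fin n)
complete n = record
  { _~_   = _≢_
  ; ~-sym = ≢-sym
  ; ~-irr = λ u≡v u≢v → u≢v u≡v
  }

-- path i is v_i (so path zero is the root); the leaves are the vertices
-- attached to v_ℓ.
data BroomVertex (ℓ m : ℕ) : Set where
  path : Fin (suc ℓ) → BroomVertex ℓ m
  leaf : Fin m → BroomVertex ℓ m

data BroomArc {ℓ m : ℕ} : Rel (BroomVertex ℓ m) 0ℓ where
  step : (i : Fin ℓ) → BroomArc (path (inject₁ i)) (path (suc i))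
  twig : (j : Fin m) → BroomArc (path (fromℕ ℓ)) (leaf j)

inject₁≢suc : ∀ {n} (i : Fin n) → inject₁ i ≢ suc i
inject₁≢suc (suc i) eq = inject₁≢suc i (suc-injective eq)

path-injective : ∀ {ℓ m i j} → path {ℓ} {m} i ≡ path j → i ≡ j
path-injective refl = refl

BroomArc⇒≢ : ∀ {ℓ m} {x y : BroomVertex ℓ m} → BroomArc x y → x ≢ y
BroomArc⇒≢ (step i) eq = inject₁≢suc i (path-injective eq)
BroomArc⇒≢ (twig j) ()

broom : (ℓ m : ℕ) → Graph (BroomVertex ℓ m)
broom ℓ m = record
  { _~_   = SymClosure BroomArc
  ; ~-sym = symmetric BroomArc
  ; ~-irr = λ { x≡y (fwd e) → BroomArc⇒≢ e x≡y
              ; x≡y (bwd e) → BroomArc⇒≢ e (sym x≡y) }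
  }

module _ {n : ℕ} (ℓ m : Fin n → ℕ) where

  -- The vertices of n disjoint brooms after identifying their roots:
  -- path i j is the vertex v_{j+1} of the i-th broom.
  data MultibroomVertex : Set where
    root : MultibroomVertex
    path : (i : Fin n) → Fin (ℓ i) → MultibroomVertex
    leaf : (i : Fin n) → Fin (m i) → MultibroomVertex

  identify : (i : Fin n) → BroomVertex (ℓ i) (m i) → MultibroomVertex
  identify i (path zero)    = root
  identify i (path (suc j)) = path i j
  identify i (leaf j)       = leaf i j

  identify-injective : ∀ i {x y} → identify i x ≡ identify i y → x ≡ y
  identify-injective i {path zero}    {path zero}    refl = refl
  identify-injective i {path (suc _)} {path (suc _)} refl = refl
  identify-injective i {leaf _}       {leaf _}       refl = refl
  identify-injective i {path zero}    {path (suc _)} ()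
  identify-injective i {path zero}    {leaf _}       ()
  identify-injective i {path (suc _)} {path zero}    ()
  identify-injective i {path (suc _)} {leaf _}       ()
  identify-injective i {leaf _}       {path zero}    ()
  identify-injective i {leaf _}       {path (suc _)} ()

  MultibroomAdj : Rel MultibroomVertex 0ℓ
  MultibroomAdj u w = ∃[ i ] ∃[ x ] ∃[ y ]
    (identify i x ≡ u × identify i y ≡ w × Graph._~_ (broom (ℓ i) (m i)) x y)

  multibroom : Graph MultibroomVertex
  multibroom = record
    { _~_   = MultibroomAdj
    ; ~-sym = λ { (i , x , y , p , q , e) →
                  i , y , x , q , p , Graph.~-sym (broom (ℓ i) (m i)) e }
    ; ~-irr = λ { refl (i , x , y , refl , q , e) →
                  Graph.~-irr (broom (ℓ i) (m i)) (sym (identify-injective i q)) e }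
    }

IsMultibroom : {V : Set} → Graph V → Set
IsMultibroom T =
  Σ[ n ∈ ℕ ] Σ[ ℓ ∈ (Fin n → ℕ) ] Σ[ m ∈ (Fin n → ℕ) ]
    (1 ≤ n × (∀ i → 1 ≤ ℓ i) × T ≅ multibroom ℓ m)

Stable : {n : ℕ} → Graph (Fin n) → Subset n → Set
Stable G S = ∀ {u v} → u ∈ S → v ∈ S → ¬ (u ~ v)
  where open Graph G

record FractionalColouring (G : FiniteGraph) (a b : ℕ) : Set where
  field
    A      : Fin a → Subset (order G)
    stable : ∀ i → Stable (graph G) (A i)
    -- tabulate builds the subset { i | v ∈ A i } of Fin a.
    covers : ∀ v → b ≤ ∣ tabulate (λ i → lookup (A i) v) ∣

record FractionallyColourableAt (G : FiniteGraph) (q : ℚ) : Set where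
  field
    a b           : ℕ
    {{a-nonZero}} : NonZero a
    {{b-nonZero}} : NonZero b
    colouring     : FractionalColouring G a b
    ratio         : q ≡ + a ℚ./ b

-- q is the minimum of the ratios a/b.  The minimum is attained for every
-- graph with at least one vertex; for the null graph there is no minimum,
-- since (1, b)-fractional colourings exist for all b.
IsFractionalChromaticNumber : FiniteGraph → ℚ → Set
IsFractionalChromaticNumber G q =
  FractionallyColourableAt G q ×
  (∀ r → FractionallyColourableAt G r → q ℚ.≤ r)

{-# OPTIONS --safe #-}
module Submission where

-- By induction on k, every weighting of a {T,K_{k+1}}-free graph has a stable set carrying a
-- constant fraction of the weight; multiplicative weights turn this into a fractional colouring.
--
-- Greedily choose a vertex x whose closed neighbourhood has maximum weight Δ in the current set A,
-- keep a heavy stable set S₀ of its neighbours, and discard the rest of the neighbourhood together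
-- with the vertices seeing a fixed proportion of S₀: by maximality of Δ these weigh O(Δ).  Now pack
-- brooms that start in S₀, run in what is left of A and do not touch one another.  Since T is not
-- induced with root x, this gets stuck after boundedly many vertices; discarding their neighbours
-- again costs O(Δ), and the remaining part S of S₀ still has weight proportional to Δ, while no
-- vertex of S starts a broom of a certain length t into the later part of the graph.
--
-- If a linearly preordered graph has stable levels and no vertex starts a broom of length t into
-- later levels, then it has a heavy stable set: for t = 0 it is degenerate, and t + 1 is reduced
-- to t by reordering the vertices by their earliest neighbour.

open import Defs
open import Data.Fin using (Fin; zero; suc; toℕ; _≟_)
open import Data.Fin.Properties using (any?; toℕ-injective; toℕ<n)
open import Data.Fin.Subset as Subset using (Subset; ∣_∣)
open import Data.Integer using (+_; +<+)
open import Data.Integer.Properties using (pos-*)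
open import Data.List using (List; []; _∷_; _++_; length; tabulate)
open import Data.List.Properties using (length-++; length-tabulate)
open import Data.List.Relation.Unary.All as All using (All; []; _∷_)
open import Data.List.Relation.Unary.All.Properties as Allₚ using ()
open import Data.List.Relation.Unary.Any as Any using (Any; here; there)
open import Data.List.Relation.Unary.Any.Properties as Anyₚ using ()
open import Data.Nat hiding (_≟_)
open import Data.Nat.Properties hiding (_≟_)
open import Data.Nat.Tactic.RingSolver using (solve-∀)
open import Data.Product using (∃-syntax; Σ-syntax; _×_; _,_; proj₁; proj₂)
open import Data.Rational as ℚ using (ℚ; 1ℚ)
open import Data.Rational.Properties using (fromℚᵘ-cong; toℚᵘ-cancel-<; toℚᵘ-fromℚᵘ)
open import Data.Rational.Unnormalised using (mkℚᵘ; *≡*; *<*)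
open import Data.Rational.Unnormalised.Properties using (<-respʳ-≃; ≃-sym)
open import Data.Sum using (_⊎_; inj₁; inj₂)
open import Data.Vec as Vec using (lookup)
open import Data.Vec.Properties using (lookup∘tabulate; []=⇒lookup)
open import Function using (_∘_; case_of_)
open import Function.Bundles using (Equivalence; Injection; mk⇔; mk↣)
open import Function.Properties.Inverse using (↔⇒↣)
open import Relation.Binary.Construct.Closure.Symmetric using (SymClosure; fwd; bwd)
open import Relation.Binary.Definitions using (tri<; tri≈; tri>)
open import Relation.Binary.PropositionalEquality
open import Relation.Nullary using (¬_; Dec; yes; no; does; ¬?; _×-dec_; _⊎-dec_; contradiction)
open import Algebra.Properties.Semiring.Sum +-*-semiring using (sum; ∑-distrib-+; ∑-comm; sum-cong-≗; *-distribˡ-sum; sum-syntax; sum-replicate-zero)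

-- Finite sums of natural numbers.

sum-mono-≤ : ∀ {n} {f g : Fin n → ℕ} → (∀ i → f i ≤ g i) → sum f ≤ sum g
sum-mono-≤ {zero}  f≤g = z≤n
sum-mono-≤ {suc n} f≤g = +-mono-≤ (f≤g zero) (sum-mono-≤ (f≤g ∘ suc))

f≤sum : ∀ {n} (f : Fin n → ℕ) i → f i ≤ sum f
f≤sum f zero    = m≤m+n _ _
f≤sum f (suc i) = ≤-trans (f≤sum (f ∘ suc) i) (m≤n+m _ _)

sum≤n*max : ∀ {n} (f : Fin n → ℕ) b → (∀ i → f i ≤ b) → sum f ≤ n * b
sum≤n*max {zero}  f b h = z≤n
sum≤n*max {suc n} f b h = +-mono-≤ (h zero) (sum≤n*max (f ∘ suc) b (h ∘ suc))

0<sum⇒∃0< : ∀ {n} (f : Fin n → ℕ) → 0 < sum f → ∃[ i ] 0 < f i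
0<sum⇒∃0< {suc n} f 0<s with f zero in eq
... | suc _ = zero , subst (0 <_) (sym eq) z<s
... | zero  = let i , p = 0<sum⇒∃0< (f ∘ suc) 0<s in suc i , p

-- Decidable sets of vertices.

record DecSet (V : Set) : Set₁ where
  no-eta-equality
  field
    mem  : V → Set
    mem? : ∀ v → Dec (mem v)
open DecSet public

module _ {V : Set} where

  infix  4 _∈_ _∉_ _⊆_
  infixl 7 _∩_
  infixl 6 _∪_ _∖_

  _∈_ _∉_ : V → DecSet V → Set
  v ∈ U = mem U v
  v ∉ U = ¬ (v ∈ U)

  _⊆_ : DecSet V → DecSet V → Set
  U ⊆ W = ∀ {v} → v ∈ U → v ∈ W

  _∩_ _∪_ _∖_ : DecSet V → DecSet V → DecSet V
  mem  (U ∩ W) v = v ∈ U × v ∈ W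
  mem? (U ∩ W) v = mem? U v ×-dec mem? W v
  mem  (U ∪ W) v = v ∈ U ⊎ v ∈ W
  mem? (U ∪ W) v = mem? U v ⊎-dec mem? W v
  mem  (U ∖ W) v = v ∈ U × v ∉ W
  mem? (U ∖ W) v = mem? U v ×-dec ¬? (mem? W v)

fibre : ∀ {V : Set} {D} → (V → Fin D) → Fin D → DecSet V
mem  (fibre c i) v = c v ≡ i
mem? (fibre c i) v = c v ≟ i

singleton : ∀ {N} → Fin N → DecSet (Fin N)
mem  (singleton x) v = x ≡ v
mem? (singleton x) v = x ≟ v

-- Indicators and weights of vertex sets.

module _ {N : ℕ} where

  private V = Fin N

  ind : DecSet V → V → ℕ
  ind U v with mem? U v
  ... | yes _ = 1
  ... | no  _ = 0

  ind-∩ : ∀ U W v → ind (U ∩ W) v ≡ ind U v * ind W v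
  ind-∩ U W v with mem? U v | mem? W v
  ... | yes _ | yes _ = refl
  ... | yes _ | no  _ = refl
  ... | no  _ | yes _ = refl
  ... | no  _ | no  _ = refl

∑-ind-singleton : ∀ {N} (x : Fin N) → ∑[ v < N ] ind (singleton x) v ≡ 1
∑-ind-singleton {suc N} zero    = cong suc (sum-replicate-zero N)
∑-ind-singleton {suc N} (suc x) = trans (sum-cong-≗ shift) (∑-ind-singleton x)
  where
  shift : ∀ v → ind (singleton (suc x)) (suc v) ≡ ind (singleton x) v
  shift v with x ≟ v
  ... | yes _ = refl
  ... | no  _ = refl

module _ {N : ℕ} where

  private V = Fin N

  opaque
    wt : (V → ℕ) → DecSet V → ℕ
    wt w U = ∑[ v < N ] (ind U v * w v)

  size : DecSet V → ℕ
  size = wt (λ _ → 1)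

  opaque
    unfolding wt

    wt-cover : ∀ w {U A B} → (∀ {v} → v ∈ U → v ∈ A ⊎ v ∈ B) → wt w U ≤ wt w A + wt w B
    wt-cover w {U} {A} {B} U⊆ = ≤-trans (sum-mono-≤ pointwise)
        (≤-reflexive (∑-distrib-+ (λ v → ind A v * w v) (λ v → ind B v * w v)))
      where
      pointwise : ∀ v → ind U v * w v ≤ ind A v * w v + ind B v * w v
      pointwise v with mem? U v | mem? A v | mem? B v
      ... | no  _ | _     | _     = z≤n
      ... | yes _ | yes _ | _     = m≤m+n _ _
      ... | yes _ | no  _ | yes _ = ≤-refl
      ... | yes u | no ¬a | no ¬b with U⊆ u
      ...   | inj₁ a = contradiction a ¬a
      ...   | inj₂ b = contradiction b ¬b

    wt-disjoint : ∀ w {U A B} → A ⊆ U → B ⊆ U → (∀ {v} → v ∈ A → v ∉ B) →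
                  wt w A + wt w B ≤ wt w U
    wt-disjoint w {U} {A} {B} A⊆U B⊆U A#B = ≤-trans
        (≤-reflexive (sym (∑-distrib-+ (λ v → ind A v * w v) (λ v → ind B v * w v))))
        (sum-mono-≤ pointwise)
      where
      pointwise : ∀ v → ind A v * w v + ind B v * w v ≤ ind U v * w v
      pointwise v with mem? U v | mem? A v | mem? B v
      ... | _     | no _  | no _  = z≤n
      ... | _     | yes a | yes b = contradiction b (A#B a)
      ... | yes _ | yes _ | no _  = ≤-reflexive (+-identityʳ _)
      ... | yes _ | no _  | yes _ = ≤-refl
      ... | no ¬u | yes a | no _  = contradiction (A⊆U a) ¬u
      ... | no ¬u | no _  | yes b = contradiction (B⊆U b) ¬u

    wt-mono : ∀ {w w′ U W} → (∀ {v} → v ∈ U → v ∈ W × w v ≤ w′ v) → wt w U ≤ wt w′ W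
    wt-mono {w} {w′} {U} {W} h = sum-mono-≤ pointwise
      where
      pointwise : ∀ v → ind U v * w v ≤ ind W v * w′ v
      pointwise v with mem? U v | mem? W v
      ... | no  _ | _      = z≤n
      ... | yes u | yes _  = +-monoˡ-≤ 0 (proj₂ (h u))
      ... | yes u | no  ¬p = contradiction (proj₁ (h u)) ¬p

  wt-⊆ : ∀ w {U W} → U ⊆ W → wt w U ≤ wt w W
  wt-⊆ w U⊆W = wt-mono λ u → U⊆W u , ≤-refl

  opaque
    unfolding wt

    wt-scale : ∀ w c U → wt (λ v → c * w v) U ≡ c * wt w U
    wt-scale w c U = trans
      (sum-cong-≗ λ v → trans (sym (*-assoc (ind U v) c (w v)))
        (trans (cong (_* w v) (*-comm (ind U v) c)) (*-assoc c (ind U v) (w v))))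
      (sym (*-distribˡ-sum c (λ v → ind U v * w v)))

    w≤wt : ∀ w {U v} → v ∈ U → w v ≤ wt w U
    w≤wt w {U} {v} v∈U = ≤-trans pointwise (f≤sum (λ v → ind U v * w v) v)
      where
      pointwise : w v ≤ ind U v * w v
      pointwise with mem? U v
      ... | yes _ = ≤-reflexive (sym (+-identityʳ _))
      ... | no ¬p = contradiction v∈U ¬p

    0<wt⇒∈ : ∀ w {U} → 0 < wt w U → ∃[ v ] (v ∈ U × 0 < w v)
    0<wt⇒∈ w {U} 0<wt with 0<sum⇒∃0< (λ v → ind U v * w v) 0<wt
    ... | v , 0<t with mem? U v
    ...   | yes v∈U = v , v∈U , ≤-trans 0<t (≤-reflexive (+-identityʳ _))

  wt-∅ : ∀ w {U} → (∀ {v} → v ∉ U) → wt w U ≡ 0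
  wt-∅ w {U} ∅ with wt w U in eq
  ... | zero  = refl
  ... | suc _ = contradiction (proj₁ (proj₂ (0<wt⇒∈ w {U} (subst (0 <_) (sym eq) z<s)))) ∅

  opaque
    unfolding wt

    wt-singleton : ∀ w x → wt w (singleton x) ≡ w x
    wt-singleton w x = begin
      ∑[ v < N ] (ind (singleton x) v * w v)  ≡⟨ sum-cong-≗ at-x ⟩
      ∑[ v < N ] (w x * ind (singleton x) v)  ≡⟨ *-distribˡ-sum (w x) (ind (singleton x)) ⟨
      w x * ∑[ v < N ] ind (singleton x) v    ≡⟨ cong (w x *_) (∑-ind-singleton x) ⟩
      w x * 1                                 ≡⟨ *-identityʳ (w x) ⟩
      w x                                     ∎
      where
      open ≡-Reasoning
      at-x : ∀ v → ind (singleton x) v * w v ≡ w x * ind (singleton x) v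
      at-x v with x ≟ v
      ... | yes refl = *-comm 1 (w x)
      ... | no  _    = sym (*-zeroʳ (w x))

    -- Double counting: both sides sum `w u * w v` over the `R`-related pairs with `u` in `A` and
    -- `v` in `B`.
    wt-swap : ∀ w A B (R : V → DecSet V) → (∀ {u v} → v ∈ R u → u ∈ R v) →
              wt (λ u → w u * wt w (B ∩ R u)) A ≡ wt (λ v → w v * wt w (A ∩ R v)) B
    wt-swap w A B R R-sym = begin
      ∑[ u < N ] (ind A u * (w u * wt w (B ∩ R u)))        ≡⟨ sum-cong-≗ (λ u → expand A B u) ⟩
      ∑[ u < N ] ∑[ v < N ] term A B u v                   ≡⟨ ∑-comm (term A B) ⟩
      ∑[ v < N ] ∑[ u < N ] term A B u v                   ≡⟨ sum-cong-≗ (λ v → sum-cong-≗ λ u → exchange u v) ⟩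
      ∑[ v < N ] ∑[ u < N ] term B A v u                   ≡⟨ sum-cong-≗ (λ v → expand B A v) ⟨
      ∑[ v < N ] (ind B v * (w v * wt w (A ∩ R v)))        ∎
      where
      open ≡-Reasoning
      term : DecSet V → DecSet V → V → V → ℕ
      term A B u v = ind A u * w u * (ind B v * ind (R u) v * w v)
      expand : ∀ A B u → ind A u * (w u * wt w (B ∩ R u)) ≡ ∑[ v < N ] term A B u v
      expand A B u = trans (sym (*-assoc (ind A u) (w u) _))
        (trans (*-distribˡ-sum (ind A u * w u) (λ v → ind (B ∩ R u) v * w v))
          (sum-cong-≗ λ v → cong (λ i → ind A u * w u * (i * w v)) (ind-∩ B (R u) v)))
      ind-sym : ∀ u v → ind (R u) v ≡ ind (R v) u
      ind-sym u v with mem? (R u) v | mem? (R v) u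
      ... | yes _ | yes _ = refl
      ... | no  _ | no  _ = refl
      ... | yes p | no ¬q = contradiction (R-sym p) ¬q
      ... | no ¬p | yes q = contradiction (R-sym q) ¬p
      rearrange : ∀ a w b r x → a * w * (b * r * x) ≡ b * x * (a * r * w)
      rearrange = solve-∀
      exchange : ∀ u v → term A B u v ≡ term B A v u
      exchange u v = trans (rearrange (ind A u) (w u) (ind B v) (ind (R u) v) (w v))
        (cong (λ r → ind B v * w v * (ind A u * r * w u)) (ind-sym u v))

    size≤ : ∀ U → size U ≤ N
    size≤ U = ≤-trans (sum≤n*max (λ v → ind U v * 1) 1 λ v → ≤-trans (≤-reflexive (*-identityʳ _)) (ind≤1 v))
                      (≤-reflexive (*-identityʳ N))
      where
      ind≤1 : ∀ v → ind U v ≤ 1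
      ind≤1 v with mem? U v
      ... | yes _ = ≤-refl
      ... | no  _ = z≤n

    -- Each vertex lies in exactly one fibre, so after exchanging the sums the inner one picks out
    -- the single index `c v`.
    wt-fibres : ∀ {D} w U (c : V → Fin D) → ∑[ i < D ] wt w (U ∩ fibre c i) ≡ wt w U
    wt-fibres {D} w U c = begin
      ∑[ i < D ] ∑[ v < N ] (ind (U ∩ fibre c i) v * w v)
        ≡⟨ ∑-comm (λ i v → ind (U ∩ fibre c i) v * w v) ⟩
      ∑[ v < N ] ∑[ i < D ] (ind (U ∩ fibre c i) v * w v)
        ≡⟨ sum-cong-≗ inner ⟩
      wt w U ∎
      where
      open ≡-Reasoning
      same : ∀ {v} i → ind (fibre c i) v ≡ ind (singleton (c v)) i
      same {v} i with c v ≟ i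
      ... | yes _ = refl
      ... | no  _ = refl
      inner : ∀ v → ∑[ i < D ] (ind (U ∩ fibre c i) v * w v) ≡ ind U v * w v
      inner v = begin
        ∑[ i < D ] (ind (U ∩ fibre c i) v * w v)
          ≡⟨ sum-cong-≗ (λ i → trans (cong (_* w v) (ind-∩ U (fibre c i) v))
               (trans (*-assoc (ind U v) _ (w v))
                 (trans (cong (ind U v *_) (*-comm _ (w v))) (sym (*-assoc (ind U v) (w v) _))))) ⟩
        ∑[ i < D ] (ind U v * w v * ind (fibre c i) v)
          ≡⟨ sym (*-distribˡ-sum (ind U v * w v) (λ i → ind (fibre c i) v)) ⟩
        ind U v * w v * ∑[ i < D ] ind (fibre c i) v
          ≡⟨ cong (ind U v * w v *_) (trans (sum-cong-≗ same) (∑-ind-singleton (c v))) ⟩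
        ind U v * w v * 1
          ≡⟨ *-identityʳ _ ⟩
        ind U v * w v ∎

wt-fibrewise : ∀ {N D} w a (U W : DecSet (Fin N)) (c : Fin N → Fin D) →
               (∀ i → wt w (U ∩ fibre c i) ≤ a * wt w (W ∩ fibre c i)) → wt w U ≤ a * wt w W
wt-fibrewise {D = D} w a U W c h = begin
  wt w U                                    ≡⟨ wt-fibres w U c ⟨
  ∑[ i < D ] wt w (U ∩ fibre c i)           ≤⟨ sum-mono-≤ h ⟩
  ∑[ i < D ] (a * wt w (W ∩ fibre c i))     ≡⟨ *-distribˡ-sum a (λ i → wt w (W ∩ fibre c i)) ⟨
  a * ∑[ i < D ] wt w (W ∩ fibre c i)       ≡⟨ cong (a *_) (wt-fibres w W c) ⟩
  a * wt w W                                ∎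
  where open ≤-Reasoning

-- Extremal elements, pigeonhole arguments and enumeration.

maximum : ∀ {D} (f : Fin (suc D) → ℕ) → ∃[ i ] (∀ j → f j ≤ f i)
maximum {zero}  f = zero , λ { zero → ≤-refl }
maximum {suc D} f with maximum (f ∘ suc)
... | i , max with ≤-total (f zero) (f (suc i))
...   | inj₁ le = suc i , λ { zero → le ; (suc j) → max j }
...   | inj₂ ge = zero , λ { zero → ≤-refl ; (suc j) → ≤-trans (max j) ge }

heavyFibre : ∀ {N D} w (U : DecSet (Fin N)) (c : Fin N → Fin (suc D)) →
             ∃[ i ] wt w U ≤ suc D * wt w (U ∩ fibre c i)
heavyFibre {D = D} w U c with maximum (λ i → wt w (U ∩ fibre c i))
... | i , max = i , subst (_≤ suc D * wt w (U ∩ fibre c i)) (wt-fibres w U c)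
                      (sum≤n*max (λ i → wt w (U ∩ fibre c i)) _ max)

-- Pigeonhole: if every colour occurred on `Q`, each of the `D` fibres would contribute at least one
-- to `size Q`.
unusedColour : ∀ {N D} (Q : DecSet (Fin N)) (c : Fin N → Fin D) → size Q < D →
               ∃[ i ] (∀ {v} → v ∈ Q → c v ≢ i)
unusedColour {D = D} Q c Q<D with any? (λ i → size (Q ∩ fibre c i) <? 1)
... | yes (i , lt) = i , λ v∈Q cv≡i → contradiction (≤-trans (w≤wt _ {Q ∩ fibre c i} (v∈Q , cv≡i)) (s≤s⁻¹ lt)) λ ()
... | no  all = contradiction Q<D (≤⇒≯ (begin
      D                                ≡⟨ *-identityʳ D ⟨
      D * 1                            ≤⟨ n≤sum (λ i → size (Q ∩ fibre c i)) (λ i → ≮⇒≥ λ lt → all (i , lt)) ⟩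
      ∑[ i < D ] size (Q ∩ fibre c i)  ≡⟨ wt-fibres (λ _ → 1) Q c ⟩
      size Q                           ∎))
  where
  open ≤-Reasoning
  n≤sum : ∀ {n} (f : Fin n → ℕ) → (∀ i → 1 ≤ f i) → n * 1 ≤ sum f
  n≤sum {zero}  f h = z≤n
  n≤sum {suc n} f h = +-mono-≤ (h zero) (n≤sum (f ∘ suc) (h ∘ suc))

argmin : ∀ {N} (Q : DecSet (Fin N)) (g : Fin N → ℕ) →
         (∃[ x ] (x ∈ Q × (∀ {v} → v ∈ Q → g x ≤ g v))) ⊎ (∀ {v} → v ∉ Q)
argmin {zero}  Q g = inj₂ λ { {()} }
argmin {suc N} Q g with argmin (record { mem = mem Q ∘ suc ; mem? = mem? Q ∘ suc }) (g ∘ suc) | mem? Q zero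
... | inj₂ ∅ | no ¬p = inj₂ λ { {zero} p → ¬p p ; {suc v} p → ∅ p }
... | inj₂ ∅ | yes p = inj₁ (zero , p , λ { {zero} _ → ≤-refl ; {suc v} q → contradiction q ∅ })
... | inj₁ (x , x∈ , min) | no ¬p =
  inj₁ (suc x , x∈ , λ { {zero} p → contradiction p ¬p ; {suc v} q → min q })
... | inj₁ (x , x∈ , min) | yes p with ≤-total (g zero) (g (suc x))
...   | inj₁ le = inj₁ (zero , p , λ { {zero} _ → ≤-refl ; {suc v} q → ≤-trans le (min q) })
...   | inj₂ ge = inj₁ (suc x , x∈ , λ { {zero} _ → ge ; {suc v} q → min q })

argmax : ∀ {N} (Q : DecSet (Fin N)) (g : Fin N → ℕ) →
         (∃[ x ] (x ∈ Q × (∀ {v} → v ∈ Q → g v ≤ g x))) ⊎ (∀ {v} → v ∉ Q)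
-- `sum g` bounds every value of `g`, so the truncated subtraction is exact and reverses the order.
argmax {N} Q g with argmin Q (λ v → sum g ∸ g v)
... | inj₂ ∅ = inj₂ ∅
... | inj₁ (x , x∈Q , min) = inj₁ (x , x∈Q , λ {v} v∈Q → begin
    g v                    ≡⟨ m∸[m∸n]≡n (f≤sum g v) ⟨
    sum g ∸ (sum g ∸ g v)  ≤⟨ ∸-monoʳ-≤ (sum g) (min v∈Q) ⟩
    sum g ∸ (sum g ∸ g x)  ≡⟨ m∸[m∸n]≡n (f≤sum g x) ⟩
    g x                    ∎)
  where open ≤-Reasoning

size-∖-singleton : ∀ {N} {U : DecSet (Fin N)} {x s} → x ∈ U → size U ≤ suc s → size (U ∖ singleton x) ≤ s
size-∖-singleton {U = U} {x} x∈U U≤ = s≤s⁻¹ (≤-trans (≤-trans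
  (+-monoˡ-≤ _ (w≤wt (λ _ → 1) {singleton x} refl))
  (wt-disjoint (λ _ → 1) {U} (λ { refl → x∈U }) proj₁ (λ x≡v v∈ → proj₂ v∈ x≡v))) U≤)

size≤1+size-∖ : ∀ {N} (U : DecSet (Fin N)) x → size U ≤ 1 + size (U ∖ singleton x)
size≤1+size-∖ U x = ≤-trans
  (wt-cover _ λ {v} v∈U → case x ≟ v of λ { (yes p) → inj₁ p ; (no ¬p) → inj₂ (v∈U , ¬p) })
  (+-monoˡ-≤ _ (≤-reflexive (wt-singleton _ x)))

enumerate : ∀ {N} m (U : DecSet (Fin N)) → m ≤ size U →
            Σ[ g ∈ (Fin m → Fin N) ] ((∀ i → g i ∈ U) × (∀ {i j} → g i ≡ g j → i ≡ j))
enumerate zero    U m≤ = (λ ()) , (λ ()) , λ { {()} }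
enumerate (suc m) U m≤ with 0<wt⇒∈ _ {U} (≤-trans z<s m≤)
... | x , x∈U , _ with enumerate m (U ∖ singleton x) (s≤s⁻¹ (≤-trans m≤ (size≤1+size-∖ U x)))
...   | g , g∈ , inj = g′ , g′∈ , inj′
  where
  g′ : Fin (suc m) → _
  g′ zero    = x
  g′ (suc i) = g i
  g′∈ : ∀ i → g′ i ∈ U
  g′∈ zero    = x∈U
  g′∈ (suc i) = proj₁ (g∈ i)
  inj′ : ∀ {i j} → g′ i ≡ g′ j → i ≡ j
  inj′ {zero}  {zero}  eq = refl
  inj′ {zero}  {suc j} eq = contradiction eq (proj₂ (g∈ j))
  inj′ {suc i} {zero}  eq = contradiction (sym eq) (proj₂ (g∈ i))
  inj′ {suc i} {suc j} eq = cong suc (inj eq)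

-- The factor obtained by induction on the broom length `t`: a colouring with `D` colours at
-- `t = 0`, and then, at each step, one further stable set and a loss of `a`.
forwardBound : ℕ → ℕ → ℕ → ℕ
forwardBound a D zero    = D
forwardBound a D (suc t) = 1 + a * forwardBound a D t

-- Cliques, stable sets and brooms inside a fixed graph.

module InGraph (G : FiniteGraph) where
  open FiniteGraph G public

  V : Set
  V = Fin order

  N[_] N⟦_⟧ : V → DecSet V
  mem  N[ y ] v = y ~ v
  mem? N[ y ] v = y ~? v
  N⟦ y ⟧ = N[ y ] ∪ singleton y

  Independent : DecSet V → Set
  Independent S = ∀ {u v} → u ∈ S → v ∈ S → ¬ u ~ v

  -- CliqueFree k excludes cliques on suc k vertices.
  CliqueFree : ℕ → DecSet V → Set
  CliqueFree zero    U = ∀ {v} → v ∉ U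
  CliqueFree (suc k) U = ∀ {x} → x ∈ U → CliqueFree k (U ∩ N[ x ])

  CliqueFree-⊆ : ∀ k {U W} → U ⊆ W → CliqueFree k W → CliqueFree k U
  CliqueFree-⊆ zero    U⊆W free u = free (U⊆W u)
  CliqueFree-⊆ (suc k) U⊆W free u =
    CliqueFree-⊆ k (λ { (v , e) → U⊆W v , e }) (free (U⊆W u))

  CliqueFree-∅ : ∀ k {U} → (∀ {v} → v ∉ U) → CliqueFree k U
  CliqueFree-∅ zero    ∅   = ∅
  CliqueFree-∅ (suc k) ∅ u = contradiction u ∅

  HasStable : ℕ → (V → ℕ) → DecSet V → Set₁
  HasStable a w U = Σ[ S ∈ DecSet V ] (S ⊆ U × Independent S × wt w U ≤ a * wt w S)

  StableBound : ℕ → ℕ → Set₁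
  StableBound k a = ∀ U → CliqueFree k U → ∀ w → HasStable a w U

  later : DecSet V → (V → ℕ) → V → DecSet V
  mem  (later F pos y) v = v ∈ F × pos y < pos v
  mem? (later F pos y) v = mem? F v ×-dec pos y <? pos v

  module Brooms (D : ℕ) where

    -- Instead of naming the leaves, ask for D neighbours of the last path vertex: when D is
    -- large, boundedness for smaller cliques yields a large stable set among them.
    HasBroom : ℕ → V → DecSet V → Set
    HasBroom zero    y U = D ≤ size (U ∩ N[ y ])
    HasBroom (suc t) y U = ∃[ z ] (z ∈ U × y ~ z × HasBroom t z (U ∖ N⟦ y ⟧))

    HasBroom? : ∀ t y U → Dec (HasBroom t y U)
    HasBroom? zero    y U = D ≤? size (U ∩ N[ y ])
    HasBroom? (suc t) y U = any? λ z → mem? U z ×-dec y ~? z ×-dec HasBroom? t z (U ∖ N⟦ y ⟧)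

    HasBroom-⊆ : ∀ t {y U W} → U ⊆ W → HasBroom t y U → HasBroom t y W
    HasBroom-⊆ zero    U⊆W D≤ = ≤-trans D≤ (wt-⊆ _ λ { (v , e) → U⊆W v , e })
    HasBroom-⊆ (suc t) U⊆W (z , z∈U , e , b) =
      z , U⊆W z∈U , e , HasBroom-⊆ t (λ { (v , ¬n) → U⊆W v , ¬n }) b

    LevelsIndependent : DecSet V → (V → ℕ) → Set
    LevelsIndependent F pos = ∀ {u v} → u ∈ F → v ∈ F → pos u ≡ pos v → ¬ u ~ v

    NoForwardBroom : ℕ → DecSet V → (V → ℕ) → Set
    NoForwardBroom t F pos = ∀ {y} → y ∈ F → ¬ HasBroom t y (later F pos y)

  -- Heavy stable sets in preordered graphs without forward brooms.

  module Forward (k a D₀ : ℕ) (bound : StableBound k a) where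

    D : ℕ
    D = suc D₀

    open Brooms D public

    -- Greedy colouring: the vertex `y` of least position is coloured last. Independent levels put
    -- all its neighbours in `F` strictly later, and without a forward broom of length 0 there are
    -- fewer than `D` of them. The bound `s` drives the recursion.
    colouring : ∀ s F pos → size F ≤ s → LevelsIndependent F pos → NoForwardBroom 0 F pos →
                Σ[ c ∈ (V → Fin D) ] (∀ {u v} → u ∈ F → v ∈ F → u ~ v → c u ≢ c v)
    colouring s F pos F≤s levels none with argmin F pos
    ... | inj₂ ∅ = (λ _ → zero) , λ u∈F → contradiction u∈F ∅
    colouring zero F pos F≤s levels none | inj₁ (y , y∈F , min) =
      contradiction (≤-trans (w≤wt (λ _ → 1) y∈F) F≤s) λ ()
    colouring (suc s) F pos F≤s levels none | inj₁ (y , y∈F , min)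
      with colouring s (F ∖ singleton y) pos (size-∖-singleton y∈F F≤s)
             (λ u v → levels (proj₁ u) (proj₁ v))
             (λ u b → none (proj₁ u) (HasBroom-⊆ 0 (λ { ((v , _) , lt) → v , lt }) b))
    ... | c , proper = c′ , proper′
      where
      sees : ∀ {v} → v ∈ F ∩ N[ y ] → v ∈ later F pos y ∩ N[ y ]
      sees (v∈F , e) = (v∈F , ≤∧≢⇒< (min v∈F) (λ eq → levels y∈F v∈F eq e)) , e
      free : ∃[ i ] (∀ {v} → v ∈ F ∩ N[ y ] → c v ≢ i)
      free = unusedColour (F ∩ N[ y ]) c (≤-<-trans (wt-⊆ _ sees) (≰⇒> (none y∈F)))
      c′ : V → Fin D
      c′ v with y ≟ v
      ... | yes _ = proj₁ free
      ... | no  _ = c v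
      proper′ : ∀ {u v} → u ∈ F → v ∈ F → u ~ v → c′ u ≢ c′ v
      proper′ {u} {v} u∈F v∈F e with y ≟ u | y ≟ v
      ... | yes refl | yes refl = contradiction e (~-irr refl)
      ... | yes refl | no _     = λ eq → proj₂ free (v∈F , e) (sym eq)
      ... | no _     | yes refl = proj₂ free (u∈F , ~-sym e)
      ... | no y≢u   | no y≢v   = proper (u∈F , y≢u) (v∈F , y≢v) e

    β : ℕ → ℕ
    β = forwardBound a D

    private
      module Step (F : DecSet V) (pos : V → ℕ) where

        backward : V → DecSet V
        mem  (backward z) y = y ∈ F × y ~ z × pos y < pos z
        mem? (backward z) y = mem? F y ×-dec y ~? z ×-dec pos y <? pos z

        -- Lexicographic by position and then by vertex number: a linear order refining `pos`, so
        -- that groups with different parents get different levels.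
        key : V → ℕ
        key y = toℕ y + pos y * order

        pos<⇒key< : ∀ {u v} → pos u < pos v → key u < key v
        pos<⇒key< {u} {v} lt = begin-strict
          toℕ u + pos u * order  <⟨ +-monoˡ-< (pos u * order) (toℕ<n u) ⟩
          suc (pos u) * order    ≤⟨ *-monoˡ-≤ order lt ⟩
          pos v * order          ≤⟨ m≤n+m _ (toℕ v) ⟩
          key v                  ∎
          where open ≤-Reasoning

        key≤⇒pos≤ : ∀ {u v} → key u ≤ key v → pos u ≤ pos v
        key≤⇒pos≤ le = ≮⇒≥ λ lt → <⇒≱ (pos<⇒key< lt) le

        key-injective : ∀ {u v} → key u ≡ key v → u ≡ v
        key-injective {u} {v} eq = toℕ-injective (+-cancelʳ-≡ (pos u * order) _ _
          (trans eq (cong (λ p → toℕ v + p * order) (sym same))))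
          where same = ≤-antisym (key≤⇒pos≤ (≤-reflexive eq)) (key≤⇒pos≤ (≤-reflexive (sym eq)))

        parent : V → V
        parent z with argmin (backward z) key
        ... | inj₁ (y , _) = y
        -- A default value without effect, since every group below lies inside `nonInitial`.
        ... | inj₂ _       = z

        nonInitial : DecSet V
        mem  nonInitial z = z ∈ F × ∃[ y ] y ∈ backward z
        mem? nonInitial z = mem? F z ×-dec any? (mem? (backward z))

        parent-least : ∀ {z} → z ∈ nonInitial →
          parent z ∈ backward z × (∀ {y} → y ∈ backward z → key (parent z) ≤ key y)
        parent-least {z} (_ , y , y∈) with argmin (backward z) key
        ... | inj₁ (_ , x∈ , min) = x∈ , min
        ... | inj₂ ∅              = contradiction y∈ ∅

    -- Order the vertices z by their earliest backward neighbour y.  A forward broom at z in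
    -- the new order extends to one at y, because no vertex of a later group is adjacent to y.
    forwardStable : ∀ t F pos → CliqueFree (suc k) F → LevelsIndependent F pos →
                    NoForwardBroom t F pos → ∀ w → HasStable (β t) w F
    forwardStable zero F pos free levels none w with colouring _ F pos ≤-refl levels none
    ... | c , proper with heavyFibre w F c
    ...   | i , le = F ∩ fibre c i , proj₁ ,
                     (λ { (u∈F , cu) (v∈F , cv) e → proper u∈F v∈F e (trans cu (sym cv)) }) , le
    forwardStable (suc t) F pos free levels none w = result
      where
      open Step F pos

      group : V → DecSet V
      group y = nonInitial ∩ fibre parent y

      -- The group of `y` lies in the neighbourhood of `y`, so `y` extends each of its cliques;
      -- hence the bound for `k` applies to it.
      group-free : ∀ y → CliqueFree k (group y)
      group-free y with mem? F y
      ... | yes y∈F = CliqueFree-⊆ k (λ { (z∈ , refl) → proj₁ z∈ , proj₁ (proj₂ (proj₁ (parent-least z∈))) }) (free y∈F)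
      ... | no  y∉F = CliqueFree-∅ k λ { (z∈ , refl) → y∉F (proj₁ (proj₁ (parent-least z∈))) }

      chosen : ∀ y → HasStable a w (group y)
      chosen y = bound (group y) (group-free y) w

      F′ : DecSet V
      mem  F′ z = z ∈ proj₁ (chosen (parent z))
      mem? F′ z = mem? (proj₁ (chosen (parent z))) z

      F′⊆ : F′ ⊆ nonInitial
      F′⊆ {z} z∈ = proj₁ (proj₁ (proj₂ (chosen (parent z))) z∈)

      F′-large : wt w nonInitial ≤ a * wt w F′
      F′-large = wt-fibrewise w a nonInitial F′ parent λ y →
        let S , S⊆ , _ , large = chosen y in
        ≤-trans large (*-monoʳ-≤ a (wt-⊆ w λ {z} z∈S →
          subst (λ y → z ∈ proj₁ (chosen y)) (sym (proj₂ (S⊆ z∈S))) z∈S , proj₂ (S⊆ z∈S)))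

      pos′ : V → ℕ
      pos′ z = key (parent z)

      -- Equal positions mean equal parents, as `key` is injective, and then both vertices lie in
      -- one chosen stable set.
      levels′ : LevelsIndependent F′ pos′
      levels′ {u} {v} u∈ v∈ eq = proj₁ (proj₂ (proj₂ (chosen (parent v))))
        (subst (λ y → u ∈ proj₁ (chosen y)) (key-injective eq) u∈) v∈

      none′ : NoForwardBroom t F′ pos′
      none′ {z} z∈ b = let (y∈F , y~z , y<z) , _ = parent-least (F′⊆ z∈) in
        none y∈F (z , (proj₁ (F′⊆ z∈) , y<z) , y~z , HasBroom-⊆ t beyond b)
        where
        beyond : later F′ pos′ z ⊆ later F pos (parent z) ∖ N⟦ parent z ⟧
        beyond {u} (u∈ , lt) with parent-least (F′⊆ z∈) | parent-least (F′⊆ u∈)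
        -- An edge from `parent z` to `u` would make `parent z` a backward neighbour of `u` with a
        -- smaller key than `parent u`.
        ... | (y∈F , _) , _ | (_ , _ , x<u) , least = (proj₁ (F′⊆ u∈) , y<u) , λ
            { (inj₁ y~u)  → <⇒≱ lt (least (y∈F , y~u , y<u))
            ; (inj₂ refl) → <-irrefl refl y<u }
          where y<u = ≤-<-trans (key≤⇒pos≤ (<⇒≤ lt)) x<u

      -- An edge inside `F` joins two different levels, and its later end then has a backward
      -- neighbour.
      initial-independent : Independent (F ∖ nonInitial)
      initial-independent {u} {v} (u∈F , u∉) (v∈F , v∉) e with <-cmp (pos u) (pos v)
      ... | tri< lt _ _ = v∉ (v∈F , u , u∈F , e , lt)
      ... | tri≈ _ eq _ = levels u∈F v∈F eq e
      ... | tri> _ _ gt = u∉ (u∈F , v , v∈F , ~-sym e , gt)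

      split : wt w F ≤ wt w (F ∖ nonInitial) + wt w nonInitial
      split = wt-cover w λ {v} v∈F → case mem? nonInitial v of λ
        { (yes p) → inj₂ p ; (no ¬p) → inj₁ (v∈F , ¬p) }

      nonInitial≤ : ∀ {s} → wt w F′ ≤ β t * s → wt w nonInitial ≤ a * β t * s
      nonInitial≤ {s} le = ≤-trans F′-large (≤-trans (*-monoʳ-≤ a le) (≤-reflexive (sym (*-assoc a (β t) s))))

      result : HasStable (β (suc t)) w F
      result with forwardStable t F′ pos′ (CliqueFree-⊆ (suc k) (proj₁ ∘ F′⊆) free) levels′ none′ w
      -- The heavier of two stable sets is kept: the initial vertices account for the summand 1 of
      -- the factor, the others for `a * β t`.
      ... | S , S⊆ , indep , large with ≤-total (wt w (F ∖ nonInitial)) (wt w S)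
      ...   | inj₁ le = S , proj₁ ∘ F′⊆ ∘ S⊆ , indep , ≤-trans split (+-mono-≤ le (nonInitial≤ large))
      ...   | inj₂ ge = F ∖ nonInitial , proj₁ , initial-independent ,
                        ≤-trans split (+-monoʳ-≤ _ (≤-trans (nonInitial≤ large) (*-monoʳ-≤ (a * β t) ge)))

-- Induced brooms in a graph.

module Embeddings (G : FiniteGraph) where
  open InGraph G

  -- An induced broom rooted at `x`. The predicate `R` exempts the root, which in the packing comes
  -- from a different set than the other vertices.
  record BroomIn (ℓ m : ℕ) (x : V) (R : V → Set) : Set where
    field
      to        : BroomVertex ℓ m → V
      to-root   : to (path zero) ≡ x
      to-rest   : ∀ u → u ≢ path zero → R (to u)
      injective : ∀ u v → to u ≡ to v → u ≡ v
      arc⇒~     : ∀ {u v} → BroomArc u v → to u ~ to v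
      ~⇒arc     : ∀ u v → to u ~ to v → SymClosure BroomArc u v

  weaken : ∀ {ℓ m x R R′} → (∀ {v} → R v → R′ v) → BroomIn ℓ m x R → BroomIn ℓ m x R′
  weaken R⊆R′ b = record
    { to = to ; to-root = to-root ; to-rest = λ u ne → R⊆R′ (to-rest u ne)
    ; injective = injective ; arc⇒~ = arc⇒~ ; ~⇒arc = ~⇒arc }
    where open BroomIn b

  star : ∀ {m y R} (g : Fin m → V) → (∀ i → y ~ g i × R (g i)) →
         (∀ i j → ¬ g i ~ g j) → (∀ {i j} → g i ≡ g j → i ≡ j) → BroomIn 0 m y R
  star {m} {y} {R} g leaves indep inj = record
    { to = to ; to-root = refl ; to-rest = to-rest ; injective = injective
    ; arc⇒~ = λ { (twig j) → proj₁ (leaves j) } ; ~⇒arc = ~⇒arc }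
    where
    to : BroomVertex 0 m → V
    to (path i) = y
    to (leaf j) = g j
    to-rest : ∀ u → u ≢ path zero → R (to u)
    to-rest (path zero) ne = contradiction refl ne
    to-rest (leaf j)    ne = proj₂ (leaves j)
    injective : ∀ u v → to u ≡ to v → u ≡ v
    injective (path zero) (path zero) eq = refl
    injective (path zero) (leaf j)    eq = contradiction (proj₁ (leaves j)) (~-irr eq)
    injective (leaf i)    (path zero) eq = contradiction (proj₁ (leaves i)) (~-irr (sym eq))
    injective (leaf i)    (leaf j)    eq = cong leaf (inj eq)
    ~⇒arc : ∀ u v → to u ~ to v → SymClosure BroomArc u v
    ~⇒arc (path zero) (path zero) e = contradiction e (~-irr refl)
    ~⇒arc (path zero) (leaf j)    e = fwd (twig j)
    ~⇒arc (leaf i)    (path zero) e = bwd (twig i)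
    ~⇒arc (leaf i)    (leaf j)    e = contradiction e (indep i j)

  shift : ∀ {t m} → BroomVertex t m → BroomVertex (suc t) m
  shift (path i) = path (suc i)
  shift (leaf j) = leaf j

  shift-arc : ∀ {t m} {u v : BroomVertex t m} →
              SymClosure BroomArc u v → SymClosure BroomArc (shift u) (shift v)
  shift-arc (fwd (step i)) = fwd (step (suc i))
  shift-arc (fwd (twig j)) = fwd (twig j)
  shift-arc (bwd (step i)) = bwd (step (suc i))
  shift-arc (bwd (twig j)) = bwd (twig j)

  -- Outside its root, the given broom avoids the closed neighbourhood of `x`; prepending `x` thus
  -- creates only the edge to `y`, and the longer broom is still induced.
  extend : ∀ {t m x y R} → x ~ y → R y → BroomIn t m y (λ v → R v × ¬ x ~ v × x ≢ v) →
           BroomIn (suc t) m x R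
  extend {t} {m} {x} {y} {R} x~y Ry b = record
    { to = to ; to-root = refl ; to-rest = to-rest ; injective = injective
    ; arc⇒~ = arc⇒~ ; ~⇒arc = ~⇒arc }
    where
    module b = BroomIn b
    to : BroomVertex (suc t) m → V
    to (path zero)    = x
    to (path (suc i)) = b.to (path i)
    to (leaf j)       = b.to (leaf j)

    x~root : x ~ b.to (path zero)
    x~root = subst (x ~_) (sym b.to-root) x~y

    x≢ : ∀ u → x ≢ b.to u
    x≢ (path zero)    eq = ~-irr eq x~root
    x≢ (path (suc i)) = proj₂ (proj₂ (b.to-rest _ λ ()))
    x≢ (leaf j)       = proj₂ (proj₂ (b.to-rest _ λ ()))

    x~⇒arc : ∀ u → x ~ b.to u → BroomArc (path zero) (shift u)
    x~⇒arc (path zero)    e = step zero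
    x~⇒arc (path (suc i)) e = contradiction e (proj₁ (proj₂ (b.to-rest _ λ ())))
    x~⇒arc (leaf j)       e = contradiction e (proj₁ (proj₂ (b.to-rest _ λ ())))

    to-rest : ∀ u → u ≢ path zero → R (to u)
    to-rest (path zero)          ne = contradiction refl ne
    to-rest (path (suc zero))    ne = subst R (sym b.to-root) Ry
    to-rest (path (suc (suc i))) ne = proj₁ (b.to-rest _ λ ())
    to-rest (leaf j)             ne = proj₁ (b.to-rest _ λ ())

    injective : ∀ u v → to u ≡ to v → u ≡ v
    injective (path zero)    (path zero)    eq = refl
    injective (path zero)    (path (suc i)) eq = contradiction eq (x≢ (path i))
    injective (path zero)    (leaf j)       eq = contradiction eq (x≢ (leaf j))
    injective (path (suc i)) (path zero)    eq = contradiction (sym eq) (x≢ (path i))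
    injective (leaf j)       (path zero)    eq = contradiction (sym eq) (x≢ (leaf j))
    injective (path (suc i)) (path (suc j)) eq = cong shift (b.injective (path i) (path j) eq)
    injective (path (suc i)) (leaf j)       eq = cong shift (b.injective (path i) (leaf j) eq)
    injective (leaf i)       (path (suc j)) eq = cong shift (b.injective (leaf i) (path j) eq)
    injective (leaf i)       (leaf j)       eq = cong shift (b.injective (leaf i) (leaf j) eq)

    arc⇒~ : ∀ {u v} → BroomArc u v → to u ~ to v
    arc⇒~ (step zero)    = x~root
    arc⇒~ (step (suc i)) = b.arc⇒~ (step i)
    arc⇒~ (twig j)       = b.arc⇒~ (twig j)

    ~⇒arc : ∀ u v → to u ~ to v → SymClosure BroomArc u v
    ~⇒arc (path zero)    (path zero)    e = contradiction e (~-irr refl)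
    ~⇒arc (path zero)    (path (suc i)) e = fwd (x~⇒arc (path i) e)
    ~⇒arc (path zero)    (leaf j)       e = fwd (x~⇒arc (leaf j) e)
    ~⇒arc (path (suc i)) (path zero)    e = bwd (x~⇒arc (path i) (~-sym e))
    ~⇒arc (leaf j)       (path zero)    e = bwd (x~⇒arc (leaf j) (~-sym e))
    ~⇒arc (path (suc i)) (path (suc j)) e = shift-arc (b.~⇒arc (path i) (path j) e)
    ~⇒arc (path (suc i)) (leaf j)       e = shift-arc (b.~⇒arc (path i) (leaf j) e)
    ~⇒arc (leaf i)       (path (suc j)) e = shift-arc (b.~⇒arc (leaf i) (path j) e)
    ~⇒arc (leaf i)       (leaf j)       e = shift-arc (b.~⇒arc (leaf i) (leaf j) e)

  module _ {k a D₀ : ℕ} (bound : StableBound k a) where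
    open Forward k a D₀ bound using (D; HasBroom)

    -- The `D` or more neighbours at the end of the path contain a stable set of size at least
    -- `D / a`, hence of size at least `m`, which supplies the leaves. Clique-freeness around `y` is
    -- asked for separately because `y` need not lie in `U`.
    broomIn : ∀ t m {y U} → a * m < D → CliqueFree k (U ∩ N[ y ]) →
              (∀ {z} → z ∈ U → CliqueFree k (U ∩ N[ z ])) →
              HasBroom t y U → BroomIn t m y (mem U)
    broomIn zero m {y} {U} am<D free-y free D≤ with bound (U ∩ N[ y ]) free-y (λ _ → 1)
    ... | S , S⊆ , indep , large with enumerate m S m≤
      where
      m≤ : m ≤ size S
      m≤ = ≮⇒≥ λ lt → <⇒≱ am<D (≤-trans D≤ (≤-trans large (*-monoʳ-≤ a (<⇒≤ lt))))
    ...   | g , g∈ , inj = star g (λ i → proj₂ (S⊆ (g∈ i)) , proj₁ (S⊆ (g∈ i)))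
                                (λ i j → indep (g∈ i) (g∈ j)) inj
    broomIn (suc t) m {y} {U} am<D free-y free (z , z∈U , y~z , b) =
      extend y~z z∈U (weaken (λ { (v∈U , v∉) → v∈U , v∉ ∘ inj₁ , v∉ ∘ inj₂ })
        (broomIn t m am<D (smaller (free z∈U)) (λ v∈ → smaller (free (proj₁ v∈))) b))
      where
      smaller : ∀ {v} → CliqueFree k (U ∩ N[ v ]) → CliqueFree k ((U ∖ N⟦ y ⟧) ∩ N[ v ])
      smaller = CliqueFree-⊆ k λ { ((u∈ , _) , e) → u∈ , e }

root? : ∀ {ℓ m} (u : BroomVertex ℓ m) → Dec (u ≡ path zero)
root? (path zero)    = yes refl
root? (path (suc i)) = no λ ()
root? (leaf j)       = no λ ()

-- The constants of the induction on the clique number.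

module Constants (n₀ : ℕ) (t m : Fin (suc n₀) → ℕ) where

  -- The number of vertices of a broom without the common root; `t j` is the length of the broom
  -- minus one.
  vertexCount : Fin (suc n₀) → ℕ
  vertexCount j = suc (t j) + m j

  -- Bounds the number of packed vertices; the additional one makes it positive.
  f : ℕ
  f = suc (sum vertexCount)

  -- `removal a` bounds the weight leaving the graph in a stage relative to the stable set kept
  -- there. `leaves a` is chosen so that each `a * m j` is less than `suc (leaves a)`. `combined`
  -- multiplies the losses from layering, from fixing one type and from excluding forward brooms.
  -- The bound for `k` is `suc (excess k)`, hence positive.
  removal leaves combined excess : ℕ → ℕ
  removal a  = (1 + 3 * f) * (4 * a)
  leaves a   = ∑[ j < suc n₀ ] (a * m j)
  combined a = removal a * (suc n₀ * ∑[ j < suc n₀ ] forwardBound a (suc (leaves a)) (t j))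
  excess zero    = 0
  excess (suc k) = combined (suc (excess k))

-- Packing pairwise untouching brooms.

module Layering (G : FiniteGraph) (n₀ : ℕ) (t m : Fin (suc n₀) → ℕ) where
  open InGraph G
  open Embeddings G
  open BroomIn using (to)
  open Constants n₀ t m

  n : ℕ
  n = suc n₀

  Untouching : (V → Set) → (V → Set) → Set
  Untouching R R′ = ∀ {u v} → R u → R′ v → ¬ u ~ v × u ≢ v

  record MultibroomIn (ℓ : Fin n → ℕ) (x : V) : Set₁ where
    field
      part     : Fin n → V → Set
      leg      : ∀ i → BroomIn (ℓ i) (m i) x (part i)
      separate : ∀ {i j} → i ≢ j → Untouching (part i) (part j)

  touched : List V → DecSet V
  mem  (touched P) v = Any (λ p → v ∈ N⟦ p ⟧) P
  mem? (touched P) v = Any.any? (λ p → mem? N⟦ p ⟧ v) P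

  -- Union bound over the list `P`; the factor `c` replaces a division of `b` by `c`.
  wt-touched : ∀ w c b X P → All (λ p → c * wt w (X ∩ N⟦ p ⟧) ≤ b) P →
               c * wt w (X ∩ touched P) ≤ length P * b
  wt-touched w c b X []      [] = ≤-reflexive (trans (cong (c *_) (wt-∅ w λ ())) (*-zeroʳ c))
  wt-touched w c b X (p ∷ P) (h ∷ hs) = begin
    c * wt w (X ∩ touched (p ∷ P))
      ≤⟨ *-monoʳ-≤ c (wt-cover w λ { (x , here q) → inj₁ (x , q) ; (x , there q) → inj₂ (x , q) }) ⟩
    c * (wt w (X ∩ N⟦ p ⟧) + wt w (X ∩ touched P))
      ≡⟨ *-distribˡ-+ c (wt w (X ∩ N⟦ p ⟧)) _ ⟩
    c * wt w (X ∩ N⟦ p ⟧) + c * wt w (X ∩ touched P)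
      ≤⟨ +-mono-≤ h (wt-touched w c b X P hs) ⟩
    b + length P * b ∎
    where open ≤-Reasoning

  vertexList : ∀ {ℓ m x R} → BroomIn ℓ m x R → List V
  vertexList b = tabulate (λ i → to b (path i)) ++ tabulate (λ j → to b (leaf j))

  length-vertexList : ∀ {ℓ m x R} (b : BroomIn ℓ m x R) → length (vertexList b) ≡ suc ℓ + m
  length-vertexList b = trans (length-++ (tabulate (λ i → to b (path i))))
    (cong₂ _+_ (length-tabulate (λ i → to b (path i))) (length-tabulate (λ j → to b (leaf j))))

  ∈-vertexList : ∀ {ℓ m x R} (b : BroomIn ℓ m x R) {Q : V → Set} u → Q (to b u) → Any Q (vertexList b)
  ∈-vertexList b (path i) q = Anyₚ.++⁺ˡ (Anyₚ.tabulate⁺ {f = λ i → to b (path i)} i q)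
  ∈-vertexList b (leaf j) q = Anyₚ.++⁺ʳ (tabulate (λ i → to b (path i))) (Anyₚ.tabulate⁺ j q)

  All-vertexList : ∀ {ℓ m x R} (b : BroomIn ℓ m x R) {Q : V → Set} → (∀ u → Q (to b u)) → All Q (vertexList b)
  All-vertexList b q = Allₚ.++⁺ (Allₚ.tabulate⁺ (q ∘ path)) (Allₚ.tabulate⁺ (q ∘ leaf))

  to-elim : ∀ {ℓ m x R} (Q : V → Set) (b : BroomIn ℓ m x R) → Q x → (∀ {v} → R v → Q v) → ∀ u → Q (to b u)
  to-elim Q b Qx R⊆Q u with root? u
  ... | yes refl = subst Q (sym (BroomIn.to-root b)) Qx
  ... | no  ne   = R⊆Q (BroomIn.to-rest b u ne)

  -- Adds membership in the image to the predicate, so that the image itself can serve as the `part`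
  -- of a leg.
  withImage : ∀ {ℓ m x R} (b : BroomIn ℓ m x R) →
              BroomIn ℓ m x (λ v → (∃[ u ] to b u ≡ v) × R v)
  withImage b = record
    { BroomIn b ; to-rest = λ u ne → (u , refl) , BroomIn.to-rest b u ne }

  module Packing {k a D₀ : ℕ} (bound : StableBound k a)
                 (B : DecSet V) (free : CliqueFree (suc k) B)
                 (am<D : ∀ j → a * m j < suc D₀) where
    open Forward k a D₀ bound

    module _ (S A : DecSet V) (S⊆B : S ⊆ B) (A⊆B : A ⊆ B) where

      record Leg (P : List V) (j : Fin n) : Set₁ where
        field
          foot    : V
          foot∈S  : foot ∈ S ∖ touched P
          shape   : BroomIn (t j) (m j) foot (mem (A ∖ touched P))
      open Leg

      leg-untouched : ∀ {P j} (l : Leg P j) u → to (shape l) u ∉ touched P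
      leg-untouched {P} l = to-elim (_∉ touched P) (shape l) (proj₂ (foot∈S l)) proj₂

      Legs : ∀ {r} → (Fin r → Fin n) → List V → Set₁
      Legs {r} ι P = Σ[ legs ∈ (∀ i → Leg P (ι i)) ]
        (∀ i j → i ≢ j → ∀ u v → ¬ to (shape (legs i)) u ~ to (shape (legs j)) v ×
                                  to (shape (legs i)) u ≢ to (shape (legs j)) v)

      Blocked : ℕ → Set
      Blocked f = Σ[ P ∈ List V ] (All (_∈ S ∪ A) P × length P ≤ f ×
        ∃[ j ] (∀ {y} → y ∈ S ∖ touched P → ¬ HasBroom (t j) y (A ∖ touched P)))

      -- Legs are chosen one by one, and the vertices of each are added to `P`, so later legs stay
      -- away from its closed neighbourhoods. The first type without an available foot gives
      -- `Blocked`. The family `ι` of types is general for the recursion; the final use has each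
      -- type once.
      pack : ∀ {r} (ι : Fin r → Fin n) P → All (_∈ S ∪ A) P →
             Blocked (sum (vertexCount ∘ ι) + length P) ⊎ Legs ι P
      pack {zero}  ι P P⊆ = inj₂ ((λ ()) , λ ())
      pack {suc r} ι P P⊆
        with any? (λ y → mem? (S ∖ touched P) y ×-dec HasBroom? (t (ι zero)) y (A ∖ touched P))
      ... | no none = inj₁ (P , P⊆ , m≤n+m _ _ , ι zero , λ y∈ b → none (_ , y∈ , b))
      ... | yes (y , y∈ , b) = result
        where
        l₀ : Leg P (ι zero)
        l₀ = record
          { foot = y ; foot∈S = y∈
          ; shape = broomIn {a = a} bound (t (ι zero)) (m (ι zero)) (am<D (ι zero))
              (CliqueFree-⊆ k (λ { ((v , _) , e) → A⊆B v , e }) (free (S⊆B (proj₁ y∈))))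
              (λ z∈ → CliqueFree-⊆ k (λ { ((v , _) , e) → A⊆B v , e }) (free (A⊆B (proj₁ z∈)))) b }
        P₀ : List V
        P₀ = vertexList (shape l₀) ++ P
        P₀⊆ : All (_∈ S ∪ A) P₀
        P₀⊆ = Allₚ.++⁺ (All-vertexList (shape l₀)
                (to-elim (_∈ S ∪ A) (shape l₀) (inj₁ (proj₁ y∈)) (inj₂ ∘ proj₁))) P⊆
        relax : ∀ {j} → Leg P₀ j → Leg P j
        relax l = record
          { foot = foot l
          ; foot∈S = proj₁ (foot∈S l) , proj₂ (foot∈S l) ∘ Anyₚ.++⁺ʳ (vertexList (shape l₀))
          ; shape = weaken (λ { (v , ¬q) → v , ¬q ∘ Anyₚ.++⁺ʳ (vertexList (shape l₀)) }) (shape l) }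
        apart : ∀ {j} (l : Leg P₀ j) u v → to (shape l) v ∉ N⟦ to (shape l₀) u ⟧
        apart l u v q = leg-untouched l v (Anyₚ.++⁺ˡ (∈-vertexList (shape l₀) u q))
        count : sum (vertexCount ∘ ι ∘ suc) + length P₀ ≡ sum (vertexCount ∘ ι) + length P
        count = trans
          (cong (λ z → sum (vertexCount ∘ ι ∘ suc) + z)
            (trans (length-++ (vertexList (shape l₀))) (cong (_+ length P) (length-vertexList (shape l₀)))))
          (swap (sum (vertexCount ∘ ι ∘ suc)) (vertexCount (ι zero)) (length P))
          where
          swap : ∀ x y z → x + (y + z) ≡ y + x + z
          swap = solve-∀
        result : Blocked (sum (vertexCount ∘ ι) + length P) ⊎ Legs ι P
        result with pack (ι ∘ suc) P₀ P₀⊆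
        ... | inj₁ (P′ , P′⊆ , le , blocked) = inj₁ (P′ , P′⊆ , ≤-trans le (≤-reflexive count) , blocked)
        ... | inj₂ (legs , cross) = inj₂ (legs′ , cross′)
          where
          legs′ : ∀ i → Leg P (ι i)
          legs′ zero    = l₀
          legs′ (suc i) = relax (legs i)
          cross′ : ∀ i j → i ≢ j → ∀ u v → ¬ to (shape (legs′ i)) u ~ to (shape (legs′ j)) v ×
                                            to (shape (legs′ i)) u ≢ to (shape (legs′ j)) v
          cross′ zero    zero    ne u v = contradiction refl ne
          cross′ zero    (suc j) ne u v = apart (legs j) u v ∘ inj₁ , apart (legs j) u v ∘ inj₂
          cross′ (suc i) zero    ne u v = apart (legs i) v u ∘ inj₁ ∘ ~-sym , apart (legs i) v u ∘ inj₂ ∘ sym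
          cross′ (suc i) (suc j) ne u v = cross i j (ne ∘ cong suc) u v

      -- `x` is adjacent to every foot and to nothing in `A`, so it can be prepended to all legs at
      -- once, raising each length by one.
      toMultibroom : ∀ {x} → S ⊆ N[ x ] → (∀ {v} → v ∈ A → v ∉ N⟦ x ⟧) →
                     Legs (λ i → i) [] → MultibroomIn (suc ∘ t) x
      toMultibroom {x} S⊆ A# (legs , cross) = record
        { part = λ i v → ∃[ u ] to (shape (legs i)) u ≡ v
        ; leg = λ i → extend (S⊆ (proj₁ (foot∈S (legs i))))
            (path zero , BroomIn.to-root (shape (legs i)))
            (weaken (λ { (im , v∈A , _) → im , A# v∈A ∘ inj₁ , A# v∈A ∘ inj₂ }) (withImage (shape (legs i))))
        ; separate = λ { {i} {j} ne (u , refl) (v , refl) → cross i j ne u v } }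

  -- Greedy decomposition into layers without forward brooms.

  module Greedy {k a₀ D₀ : ℕ} (bound : StableBound k (suc a₀))
                (am<D : ∀ j → suc a₀ * m j < suc D₀)
                (noMultibroom : ∀ {x} → ¬ MultibroomIn (suc ∘ t) x) where
    open Forward k (suc a₀) D₀ bound

    a K : ℕ
    a = suc a₀
    K = removal a

    module _ (B : DecSet V) (free : CliqueFree (suc k) B) (w : V → ℕ) where

      -- A stage removes A ∖ A′ and keeps S, which the later stages can only see in A′.
      record Stage (A : DecSet V) : Set₁ where
        field
          S A′     : DecSet V
          type     : Fin n
          S⊆       : S ⊆ A
          A′⊆      : A′ ⊆ A
          disjoint : ∀ {v} → v ∈ A′ → v ∉ S
          indep    : Independent S
          removed  : ∃[ x ] (x ∈ A × x ∉ A′)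
          heavy    : wt w A ≤ K * wt w S + wt w A′
          none     : ∀ {y} → y ∈ S → ¬ HasBroom (t type) y A′

      -- A broom of any length at `y` uses a neighbour of `y`; for length 0 this holds because `D`
      -- is positive.
      noBroomBeyond : ∀ s {y A} → ¬ HasBroom s y (A ∖ N⟦ y ⟧)
      noBroomBeyond zero    D≤ = contradiction (≤-trans D≤ (≤-reflexive
        (wt-∅ _ λ { ((_ , y≁v) , y~v) → y≁v (inj₁ y~v) }))) λ ()
      noBroomBeyond (suc s) (z , (_ , y≁z) , y~z , _) = y≁z (inj₁ y~z)

      stage : ∀ A → A ⊆ B → 0 < wt w A → Stage A
      stage A A⊆B 0<A with argmax A (λ x → wt w (A ∩ N⟦ x ⟧))
      ... | inj₂ ∅ = contradiction (proj₁ (proj₂ (0<wt⇒∈ w 0<A))) ∅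
      ... | inj₁ (x , x∈A , max) = result
        where
        open ≤-Reasoning

        Δ : ℕ
        Δ = wt w (A ∩ N⟦ x ⟧)

        w≤Δ : ∀ {y} → y ∈ A → w y ≤ Δ
        w≤Δ y∈A = ≤-trans (w≤wt w (y∈A , inj₂ refl)) (max y∈A)

        0<Δ : 0 < Δ
        0<Δ with 0<wt⇒∈ w 0<A
        ... | y , y∈A , 0<y = ≤-trans 0<y (w≤Δ y∈A)

        -- A vertex with at least a `1 / (4 * f * a)` share of `Δ` forms a stage alone. Once its
        -- neighbours are discarded it starts no broom, so any type will do.
        heavyVertex : ∀ {y} → y ∈ A → Δ ≤ 4 * f * a * w y → Stage A
        heavyVertex {y} y∈A Δ≤ = record
          { S = singleton y ; A′ = A ∖ N⟦ y ⟧ ; type = zero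
          ; S⊆ = λ { refl → y∈A } ; A′⊆ = proj₁
          ; disjoint = λ { (_ , y∉) y≡v → y∉ (inj₂ y≡v) }
          ; indep = λ { refl refl → ~-irr refl }
          ; removed = y , y∈A , λ y∈ → proj₂ y∈ (inj₂ refl)
          ; heavy = begin
              wt w A
                ≤⟨ wt-cover w (λ {v} v∈A → case mem? N⟦ y ⟧ v of λ { (yes p) → inj₁ (v∈A , p) ; (no ¬p) → inj₂ (v∈A , ¬p) }) ⟩
              wt w (A ∩ N⟦ y ⟧) + wt w (A ∖ N⟦ y ⟧)
                ≤⟨ +-monoˡ-≤ _ (≤-trans (max y∈A) Δ≤) ⟩
              4 * f * a * w y + wt w (A ∖ N⟦ y ⟧)
                ≤⟨ +-monoˡ-≤ _ (≤-trans (m≤m+n _ _) (≤-reflexive (sym (bigger f a (w y))))) ⟩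
              K * w y + wt w (A ∖ N⟦ y ⟧)
                ≡⟨ cong (λ z → K * z + wt w (A ∖ N⟦ y ⟧)) (wt-singleton w y) ⟨
              K * wt w (singleton y) + wt w (A ∖ N⟦ y ⟧) ∎
          ; none = λ { refl → noBroomBeyond (t zero) } }
          where
          bigger : ∀ f a w → (1 + 3 * f) * (4 * a) * w ≡ 4 * f * a * w + (4 * a + 8 * f * a) * w
          bigger = solve-∀

        module Light (light : ∀ {y} → y ∈ A → 4 * f * a * w y < Δ) where

          -- As `4 * f * a` is at least 2, the light vertex `x` carries at most half of `Δ`, and its
          -- open neighbourhood carries the rest.
          Δ≤2N : Δ ≤ 2 * wt w (A ∩ N[ x ])
          Δ≤2N = +-cancelˡ-≤ Δ _ _ (begin
            Δ + Δ                              ≤⟨ +-mono-≤ half half ⟩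
            (w x + N) + (w x + N)              ≡⟨ double (w x) N ⟩
            2 * w x + 2 * N                    ≤⟨ +-monoˡ-≤ _ (≤-trans (*-monoˡ-≤ (w x) 2≤) (<⇒≤ (light x∈A))) ⟩
            Δ + 2 * N ∎)
            where
            N = wt w (A ∩ N[ x ])
            half : Δ ≤ w x + N
            half = ≤-trans (wt-cover w λ { (v , inj₁ e) → inj₂ (v , e) ; (_ , inj₂ refl) → inj₁ refl })
                           (+-monoˡ-≤ _ (≤-reflexive (wt-singleton w x)))
            double : ∀ x y → (x + y) + (x + y) ≡ 2 * x + 2 * y
            double = solve-∀
            2≤ : 2 ≤ 4 * f * a
            2≤ = *-mono-≤ {2} {4 * f} {1} {a} (*-mono-≤ {2} {4} {1} {f} (s≤s (s≤s z≤n)) (s≤s z≤n)) (s≤s z≤n)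

          large : HasStable a w (A ∩ N[ x ])
          large = bound (A ∩ N[ x ]) (CliqueFree-⊆ k (λ { (v , e) → A⊆B v , e }) (free (A⊆B x∈A))) w

          S₀ : DecSet V
          S₀ = proj₁ large

          S₀⊆ : S₀ ⊆ A ∩ N[ x ]
          S₀⊆ = proj₁ (proj₂ large)

          S₀-indep : Independent S₀
          S₀-indep = proj₁ (proj₂ (proj₂ large))

          s : ℕ
          s = wt w S₀

          Δ≤2as : Δ ≤ 2 * a * s
          Δ≤2as = ≤-trans Δ≤2N (≤-trans (*-monoʳ-≤ 2 (proj₂ (proj₂ (proj₂ large))))
                    (≤-reflexive (sym (*-assoc 2 a s))))

          0<s : 0 < s
          0<s = n≢0⇒n>0 λ s≡0 → <⇒≱ 0<Δ (≤-trans Δ≤2as (≤-reflexive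
                  (trans (cong (2 * a *_) s≡0) (*-zeroʳ (2 * a)))))

          -- `u` touches at most a `1 / (2 * f)` share of `S₀`, so up to `f` such vertices together
          -- touch at most half of it.
          Slight : V → Set
          Slight u = 2 * f * wt w (S₀ ∩ N⟦ u ⟧) ≤ s

          dominating : DecSet V
          mem  dominating u = s < 2 * f * wt w (S₀ ∩ N⟦ u ⟧)
          mem? dominating u = s <? 2 * f * wt w (S₀ ∩ N⟦ u ⟧)

          -- Few vertices dominate a fixed proportion of S₀: count the pairs of adjacent
          -- vertices of A and S₀ by weight, using that no neighbourhood outweighs Δ.
          dominating-small : wt w (A ∩ dominating) ≤ 2 * f * Δ
          dominating-small = *-cancelˡ-≤ s {{>-nonZero 0<s}} (begin
            s * wt w (A ∩ dominating)
              ≡⟨ wt-scale w s (A ∩ dominating) ⟨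
            wt (λ u → s * w u) (A ∩ dominating)
              ≤⟨ wt-mono (λ {u} (u∈A , dom) → u∈A , ≤-trans (*-monoˡ-≤ (w u) (<⇒≤ dom))
                   (≤-reflexive (shuffle (2 * f) (wt w (S₀ ∩ N⟦ u ⟧)) (w u)))) ⟩
            wt (λ u → 2 * f * (w u * wt w (S₀ ∩ N⟦ u ⟧))) A
              ≡⟨ wt-scale (λ u → w u * wt w (S₀ ∩ N⟦ u ⟧)) (2 * f) A ⟩
            2 * f * wt (λ u → w u * wt w (S₀ ∩ N⟦ u ⟧)) A
              ≡⟨ cong (2 * f *_) (wt-swap w A S₀ N⟦_⟧ λ { (inj₁ e) → inj₁ (~-sym e) ; (inj₂ eq) → inj₂ (sym eq) }) ⟩
            2 * f * wt (λ v → w v * wt w (A ∩ N⟦ v ⟧)) S₀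
              ≤⟨ *-monoʳ-≤ (2 * f) (wt-mono λ {v} v∈ → v∈ , ≤-trans (*-monoʳ-≤ (w v) (max (proj₁ (S₀⊆ v∈))))
                   (≤-reflexive (*-comm (w v) Δ))) ⟩
            2 * f * wt (λ v → Δ * w v) S₀
              ≡⟨ cong (2 * f *_) (wt-scale w Δ S₀) ⟩
            2 * f * (Δ * s)
              ≡⟨ trans (sym (*-assoc (2 * f) Δ s)) (*-comm (2 * f * Δ) s) ⟩
            s * (2 * f * Δ) ∎)
            where
            shuffle : ∀ x y z → x * y * z ≡ x * (z * y)
            shuffle = solve-∀

          A₁ : DecSet V
          A₁ = (A ∖ N⟦ x ⟧) ∖ dominating

          -- Vertices of `A₁` are not dominating. For `p` in `S₀` independence leaves only `p`
          -- itself, and the threshold `4 * f * a` of `light` is chosen to make its weight small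
          -- compared with `s`.
          slight : ∀ {p} → p ∈ S₀ ∪ A₁ → Slight p
          slight {p} (inj₂ (_ , ¬dom)) = ≮⇒≥ ¬dom
          slight {p} (inj₁ p∈) = *-cancelˡ-≤ (2 * a) (begin
            2 * a * (2 * f * wt w (S₀ ∩ N⟦ p ⟧))
              ≤⟨ *-monoʳ-≤ (2 * a) (*-monoʳ-≤ (2 * f) (wt-⊆ w λ
                   { (v∈ , inj₁ e) → contradiction e (S₀-indep p∈ v∈) ; (_ , inj₂ eq) → eq })) ⟩
            2 * a * (2 * f * wt w (singleton p))
              ≡⟨ cong (λ z → 2 * a * (2 * f * z)) (wt-singleton w p) ⟩
            2 * a * (2 * f * w p)
              ≡⟨ collect a f (w p) ⟩
            4 * f * a * w p
              ≤⟨ <⇒≤ (light (proj₁ (S₀⊆ p∈))) ⟩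
            Δ
              ≤⟨ Δ≤2as ⟩
            2 * a * s ∎)
            where
            collect : ∀ a f w → 2 * a * (2 * f * w) ≡ 4 * f * a * w
            collect = solve-∀

          A₁⊆A : A₁ ⊆ A
          A₁⊆A = proj₁ ∘ proj₁

          open Packing {a = a} bound B free am<D

          result : Stage A
          result with pack S₀ A₁ (A⊆B ∘ proj₁ ∘ S₀⊆) (A⊆B ∘ A₁⊆A) (λ i → i) [] []
          ... | inj₂ legs = contradiction
                (toMultibroom S₀ A₁ (A⊆B ∘ proj₁ ∘ S₀⊆) (A⊆B ∘ A₁⊆A) (proj₂ ∘ S₀⊆) (proj₂ ∘ proj₁) legs)
                noMultibroom
          ... | inj₁ (P , P⊆ , P≤ , j , blocked) = record
            { S = S₀ ∖ touched P ; A′ = A₁ ∖ touched P ; type = j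
            ; S⊆ = proj₁ ∘ S₀⊆ ∘ proj₁ ; A′⊆ = A₁⊆A ∘ proj₁
            ; disjoint = λ { ((( _ , x≁) , _) , _) (v∈ , _) → x≁ (inj₁ (proj₂ (S₀⊆ v∈))) }
            ; indep = λ { (u∈ , _) (v∈ , _) → S₀-indep u∈ v∈ }
            ; removed = x , x∈A , λ { (((_ , x≁) , _) , _) → x≁ (inj₂ refl) }
            -- `A` is covered by the closed neighbourhood of `x`, the dominating vertices, the
            -- vertices touched by `P` and the remainder `A′`. The first three weigh at most `Δ`,
            -- `2 * f * Δ` and `f * Δ`, and `Δ` is at most `4 * a` times the weight of the set kept.
            ; heavy = begin
                wt w A
                  ≤⟨ wt-cover w (λ {v} v∈A → case mem? N⟦ x ⟧ v of λ { (yes p) → inj₁ (v∈A , p) ; (no ¬p) → inj₂ (v∈A , ¬p) }) ⟩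
                Δ + wt w (A ∖ N⟦ x ⟧)
                  ≤⟨ +-monoʳ-≤ Δ (wt-cover w {A ∖ N⟦ x ⟧} {A ∩ dominating} {A₁} λ {v} v∈ → case mem? dominating v of λ
                       { (yes p) → inj₁ (proj₁ v∈ , p) ; (no ¬p) → inj₂ (v∈ , ¬p) }) ⟩
                Δ + (wt w (A ∩ dominating) + wt w A₁)
                  ≤⟨ +-monoʳ-≤ Δ (+-mono-≤ dominating-small (wt-cover w {A₁} {A ∩ touched P} {A₁ ∖ touched P} λ {v} v∈ → case mem? (touched P) v of λ
                       { (yes p) → inj₁ (A₁⊆A v∈ , p) ; (no ¬p) → inj₂ (v∈ , ¬p) })) ⟩
                Δ + (2 * f * Δ + (wt w (A ∩ touched P) + wt w (A₁ ∖ touched P)))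
                  ≤⟨ +-monoʳ-≤ Δ (+-monoʳ-≤ (2 * f * Δ) (+-monoˡ-≤ _ A-touched)) ⟩
                Δ + (2 * f * Δ + (f * Δ + wt w (A₁ ∖ touched P)))
                  ≡⟨ collect f Δ (wt w (A₁ ∖ touched P)) ⟩
                (1 + 3 * f) * Δ + wt w (A₁ ∖ touched P)
                  ≤⟨ +-monoˡ-≤ _ (*-monoʳ-≤ (1 + 3 * f) (≤-trans Δ≤2as (*-monoʳ-≤ (2 * a) s≤2S))) ⟩
                (1 + 3 * f) * (2 * a * (2 * wt w (S₀ ∖ touched P))) + wt w (A₁ ∖ touched P)
                  ≡⟨ cong (_+ wt w (A₁ ∖ touched P)) (assemble f a (wt w (S₀ ∖ touched P))) ⟩
                K * wt w (S₀ ∖ touched P) + wt w (A₁ ∖ touched P) ∎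
            ; none = blocked }
            where
            collect : ∀ f Δ r → Δ + (2 * f * Δ + (f * Δ + r)) ≡ (1 + 3 * f) * Δ + r
            collect = solve-∀
            assemble : ∀ f a s → (1 + 3 * f) * (2 * a * (2 * s)) ≡ (1 + 3 * f) * (4 * a) * s
            assemble = solve-∀
            P≤f : length P ≤ f
            P≤f = ≤-trans P≤ (≤-trans (≤-reflexive (+-identityʳ _)) (n≤1+n _))
            A-touched : wt w (A ∩ touched P) ≤ f * Δ
            A-touched = begin
              wt w (A ∩ touched P)      ≡⟨ *-identityˡ _ ⟨
              1 * wt w (A ∩ touched P)  ≤⟨ wt-touched w 1 Δ A P (All.map (λ {p} p∈ → ≤-trans (≤-reflexive (*-identityˡ _))
                                             (max (case p∈ of λ { (inj₁ q) → proj₁ (S₀⊆ q) ; (inj₂ q) → A₁⊆A q }))) P⊆) ⟩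
              length P * Δ              ≤⟨ *-monoˡ-≤ Δ P≤f ⟩
              f * Δ                     ∎
            S-touched : 2 * wt w (S₀ ∩ touched P) ≤ s
            S-touched = *-cancelˡ-≤ f (begin
              f * (2 * wt w (S₀ ∩ touched P))  ≡⟨ trans (sym (*-assoc f 2 (wt w (S₀ ∩ touched P)))) (cong (_* wt w (S₀ ∩ touched P)) (*-comm f 2)) ⟩
              2 * f * wt w (S₀ ∩ touched P)    ≤⟨ wt-touched w (2 * f) s S₀ P (All.map slight P⊆) ⟩
              length P * s                     ≤⟨ *-monoˡ-≤ s P≤f ⟩
              f * s                            ∎)
            s≤2S : s ≤ 2 * wt w (S₀ ∖ touched P)
            s≤2S = +-cancelˡ-≤ s _ _ (begin
              s + s
                ≡⟨ cong (λ z → s + z) (+-identityʳ s) ⟨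
              2 * s
                ≤⟨ *-monoʳ-≤ 2 (wt-cover w {S₀} {S₀ ∩ touched P} {S₀ ∖ touched P} λ {v} v∈ → case mem? (touched P) v of λ
                     { (yes p) → inj₁ (v∈ , p) ; (no ¬p) → inj₂ (v∈ , ¬p) }) ⟩
              2 * (wt w (S₀ ∩ touched P) + wt w (S₀ ∖ touched P))
                ≡⟨ *-distribˡ-+ 2 (wt w (S₀ ∩ touched P)) _ ⟩
              2 * wt w (S₀ ∩ touched P) + 2 * wt w (S₀ ∖ touched P)
                ≤⟨ +-monoˡ-≤ _ S-touched ⟩
              s + 2 * wt w (S₀ ∖ touched P) ∎)

        result : Stage A
        result with any? (λ y → mem? A y ×-dec Δ ≤? 4 * f * a * w y)
        ... | yes (y , y∈A , Δ≤) = heavyVertex y∈A Δ≤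
        ... | no  none           = Light.result λ y∈A → ≰⇒> λ Δ≤ → none (_ , y∈A , Δ≤)

      record Layers (A : DecSet V) : Set₁ where
        field
          F      : DecSet V
          pos    : V → ℕ
          type   : V → Fin n
          F⊆     : F ⊆ A
          heavy  : wt w A ≤ K * wt w F
          levels : LevelsIndependent F pos
          none   : ∀ {y} → y ∈ F → ¬ HasBroom (t (type y)) y (later F pos y)

      -- Iterates `stage` until no weight is left; each stage removes a vertex, so the size bound
      -- `s` decreases, and the inequalities `heavy` add up.
      layers : ∀ s A → size A ≤ s → A ⊆ B → Layers A
      layers s A A≤s A⊆B with wt w A ≤? 0
      -- With no weight left, the empty set serves as `F`.
      ... | yes A≤0 = record
        { F = A ∖ A ; pos = λ _ → 0 ; type = λ _ → zero ; F⊆ = proj₁ ; heavy = ≤-trans A≤0 z≤n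
        ; levels = λ { (u , ¬u) → contradiction u ¬u } ; none = λ { (u , ¬u) → contradiction u ¬u } }
      ... | no A≰0 with stage A A⊆B (≰⇒> A≰0)
      layers zero A A≤0 A⊆B | no A≰0 | st =
        contradiction (≤-trans (w≤wt (λ _ → 1) (proj₁ (proj₂ (Stage.removed st)))) A≤0) λ ()
      layers (suc s) A A≤s A⊆B | no A≰0 | st
        with layers s (Stage.A′ st) smaller (A⊆B ∘ Stage.A′⊆ st)
        where
        smaller : size (Stage.A′ st) ≤ s
        smaller with Stage.removed st
        ... | x , x∈A , x∉ = ≤-trans (wt-⊆ _ λ v∈ → Stage.A′⊆ st v∈ , λ { refl → x∉ v∈ })
                               (size-∖-singleton x∈A A≤s)
      ... | L = record
        { F = S ∪ L.F ; pos = pos ; type = type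
        ; F⊆ = λ { (inj₁ v∈) → S⊆ v∈ ; (inj₂ v∈) → A′⊆ (L.F⊆ v∈) }
        ; heavy = begin
            wt w A                       ≤⟨ heavy ⟩
            K * wt w S + wt w A′         ≤⟨ +-monoʳ-≤ (K * wt w S) L.heavy ⟩
            K * wt w S + K * wt w L.F    ≡⟨ *-distribˡ-+ K (wt w S) (wt w L.F) ⟨
            K * (wt w S + wt w L.F)      ≤⟨ *-monoʳ-≤ K (wt-disjoint w inj₁ inj₂ λ v∈S v∈F → disjoint (L.F⊆ v∈F) v∈S) ⟩
            K * wt w (S ∪ L.F)           ∎
        ; levels = levels
        ; none = none′ }
        where
        open ≤-Reasoning
        open Stage st hiding (type)
        module L = Layers L
        -- Positions count stages: `S` comes first, and the remaining layers, shifted by one, lie in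
        -- `A′`, where `S` starts no broom of its type.
        pos : V → ℕ
        pos v with mem? S v
        ... | yes _ = 0
        ... | no  _ = suc (L.pos v)
        type : V → Fin n
        type v with mem? S v
        ... | yes _ = Stage.type st
        ... | no  _ = L.type v
        outside : ∀ {v} → v ∈ S ∪ L.F → v ∉ S → v ∈ L.F
        outside (inj₁ v∈S) v∉S = contradiction v∈S v∉S
        outside (inj₂ v∈F) _   = v∈F
        levels : LevelsIndependent (S ∪ L.F) pos
        levels {u} {v} u∈ v∈ eq with mem? S u | mem? S v
        ... | yes p | yes q = indep p q
        ... | no  p | no  q = L.levels (outside u∈ p) (outside v∈ q) (cong pred eq)
        beyond-S : ∀ {y} → later (S ∪ L.F) pos y ⊆ A′
        beyond-S {y} {v} (v∈ , lt) with mem? S v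
        ... | no q = L.F⊆ (outside v∈ q)
        beyond-F : ∀ {y} → y ∉ S → later (S ∪ L.F) pos y ⊆ later L.F L.pos y
        beyond-F {y} p {v} (v∈ , lt) with mem? S y | mem? S v
        ... | yes q | _    = contradiction q p
        ... | no _  | no q = outside v∈ q , s≤s⁻¹ lt
        none′ : ∀ {y} → y ∈ S ∪ L.F → ¬ HasBroom (t (type y)) y (later (S ∪ L.F) pos y)
        none′ {y} y∈ b with mem? S y
        ... | yes p = none p (HasBroom-⊆ (t (Stage.type st)) beyond-S b)
        ... | no  p = L.none (outside y∈ p) (HasBroom-⊆ (t (L.type y)) (beyond-F p) b)

      -- Restricting to the heaviest of the `n` types leaves a single broom length to exclude, at
      -- the cost of a factor `n`; then `forwardStable` applies.
      greedyStable : HasStable (K * (n * sum (β ∘ t))) w B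
      greedyStable with layers _ B ≤-refl (λ v → v)
      ... | L with heavyFibre w (Layers.F L) (Layers.type L)
      ...   | j , F≤ with forwardStable (t j) (Layers.F L ∩ fibre (Layers.type L) j) (Layers.pos L)
                        (CliqueFree-⊆ (suc k) (Layers.F⊆ L ∘ proj₁) free)
                        (λ u v → Layers.levels L (proj₁ u) (proj₁ v))
                        (λ { (y∈F , refl) b → Layers.none L y∈F (HasBroom-⊆ (t j) (λ { ((v , _) , lt) → v , lt }) b) })
                        w
      ...     | S , S⊆ , indep , Fⱼ≤ = S , Layers.F⊆ L ∘ proj₁ ∘ S⊆ , indep , (begin
        wt w B                                   ≤⟨ Layers.heavy L ⟩
        K * wt w (Layers.F L)                    ≤⟨ *-monoʳ-≤ K F≤ ⟩
        K * (n * wt w Fⱼ)                        ≤⟨ *-monoʳ-≤ K (*-monoʳ-≤ n Fⱼ≤) ⟩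
        K * (n * (β (t j) * wt w S))             ≤⟨ *-monoʳ-≤ K (*-monoʳ-≤ n (*-monoˡ-≤ (wt w S) (f≤sum (β ∘ t) j))) ⟩
        K * (n * (sum (β ∘ t) * wt w S))         ≡⟨ cong (K *_) (*-assoc n (sum (β ∘ t)) (wt w S)) ⟨
        K * (n * sum (β ∘ t) * wt w S)           ≡⟨ *-assoc K (n * sum (β ∘ t)) (wt w S) ⟨
        K * (n * sum (β ∘ t)) * wt w S           ∎)
        where
        open ≤-Reasoning
        Fⱼ : DecSet V
        Fⱼ = Layers.F L ∩ fibre (Layers.type L) j

  -- Induction on `k`: the bound for `k` handles neighbourhoods, both when a heavy stable set is
  -- sought in one and when leaves are extracted.
  stableBound : (∀ {x} → ¬ MultibroomIn (suc ∘ t) x) → ∀ k → StableBound k (suc (excess k))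
  stableBound noMultibroom zero    U ∅    w =
    U , (λ v → v) , (λ u → contradiction u ∅) , ≤-reflexive (sym (*-identityˡ _))
  stableBound noMultibroom (suc k) U free w =
    let S , S⊆ , indep , U≤ = greedyStable U free w in
    -- The additional `wt w S` comes from the `suc` in the bound.
    S , S⊆ , indep , ≤-trans U≤ (m≤n+m _ (wt w S))
    where
    a = suc (excess k)
    open Greedy {k} {excess k} {leaves a} (stableBound noMultibroom k)
      (λ j → s≤s (f≤sum (λ j → a * m j) j)) noMultibroom

-- Translation to forbidden induced subgraphs.

≅-copy : ∀ {U V W : Set} {T : Graph U} {H : Graph V} {G : Graph W} →
         T ≅ H → InducedCopy H G → InducedCopy T G
≅-copy T≅H copy = record
  { vertices = mk↣ (λ eq → Injection.injective (↔⇒↣ T≅H.vertices) (Injection.injective copy.vertices eq))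
  ; edges = λ u v → mk⇔
      (Equivalence.to (copy.edges _ _) ∘ Equivalence.to (T≅H.edges u v))
      (Equivalence.from (T≅H.edges u v) ∘ Equivalence.from (copy.edges _ _)) }
  where
  module T≅H = _≅_ T≅H
  module copy = InducedCopy copy

module _ (G : FiniteGraph) where
  open InGraph G
  open Embeddings G

  allVertices : DecSet V
  mem  allVertices v = v ≡ v
  mem? allVertices v = yes refl

  -- A clique found inside `U` and the neighbourhood of `x` in `U` extends by `x`, so excluding
  -- cliques passes down the recursive definition.
  cliqueFree : ∀ k → complete (suc k) -free graph → CliqueFree k allVertices
  cliqueFree k free = go k allVertices λ (g , _ , adj) → free record
    { vertices = mk↣ {to = g} (λ {i} {j} eq → case i ≟ j of λ
        { (yes i≡j) → i≡j ; (no i≢j) → contradiction (adj i j i≢j) (~-irr eq) })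
    ; edges = λ i j → mk⇔ (adj i j) λ { e refl → ~-irr refl e } }
    where
    go : ∀ k U → ¬ (Σ[ g ∈ (Fin (suc k) → V) ] ((∀ i → g i ∈ U) × (∀ i j → i ≢ j → g i ~ g j))) →
         CliqueFree k U
    go zero    U none v∈U = none ((λ _ → _) , (λ _ → v∈U) , λ { zero zero ne → contradiction refl ne })
    go (suc k) U none {x} x∈U = go k (U ∩ N[ x ]) λ (g , g∈ , adj) → none
      ( (λ { zero → x ; (suc i) → g i })
      , (λ { zero → x∈U ; (suc i) → proj₁ (g∈ i) })
      , λ { zero    zero    ne → contradiction refl ne
          ; zero    (suc j) ne → proj₂ (g∈ j)
          ; (suc i) zero    ne → ~-sym (proj₂ (g∈ i))
          ; (suc i) (suc j) ne → adj i j (ne ∘ cong suc) } )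

  module _ {n₀ : ℕ} (ℓ m : Fin (suc n₀) → ℕ) (ℓ≥1 : ∀ i → 1 ≤ ℓ i) where
    open Layering G n₀ (pred ∘ ℓ) m

    lengthen : ∀ {x} → MultibroomIn (λ i → suc (pred (ℓ i))) x → MultibroomIn ℓ x
    lengthen M = record
      { part = M.part ; separate = M.separate
      ; leg = λ i → subst (λ l → BroomIn l (m i) _ (M.part i)) (suc-pred (ℓ i) {{>-nonZero (ℓ≥1 i)}}) (M.leg i) }
      where module M = MultibroomIn M

    module _ {x : V} (M : MultibroomIn ℓ x) where
      open MultibroomIn M
      module leg i = BroomIn (leg i)

      embed : MultibroomVertex ℓ m → V
      embed root       = x
      embed (path i j) = leg.to i (path (suc j))
      embed (leaf i j) = leg.to i (leaf j)

      embed-identify : ∀ i u → embed (identify ℓ m i u) ≡ leg.to i u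
      embed-identify i (path zero)    = sym (leg.to-root i)
      embed-identify i (path (suc j)) = refl
      embed-identify i (leaf j)       = refl

      -- Distinguishes vertices by leg, which treats path vertices and leaves uniformly.
      data View : MultibroomVertex ℓ m → Set where
        isRoot : View root
        inLeg  : ∀ i u → u ≢ path zero → View (identify ℓ m i u)

      view : ∀ u → View u
      view root       = isRoot
      view (path i j) = inLeg i (path (suc j)) λ ()
      view (leaf i j) = inLeg i (leaf j) λ ()

      adj⇒~ : ∀ {u v} → MultibroomAdj ℓ m u v → embed u ~ embed v
      adj⇒~ (i , p , q , refl , refl , e) =
        subst₂ _~_ (sym (embed-identify i p)) (sym (embed-identify i q)) (adjacent e)
        where
        adjacent : ∀ {p q} → SymClosure BroomArc p q → leg.to i p ~ leg.to i q
        adjacent (fwd a) = leg.arc⇒~ i a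
        adjacent (bwd a) = ~-sym (leg.arc⇒~ i a)

      sameLeg : ∀ i p q → embed (identify ℓ m i p) ~ embed (identify ℓ m i q) →
                MultibroomAdj ℓ m (identify ℓ m i p) (identify ℓ m i q)
      sameLeg i p q e = i , p , q , refl , refl ,
        leg.~⇒arc i p q (subst₂ _~_ (embed-identify i p) (embed-identify i q) e)

      sameLeg-≡ : ∀ i p q → embed (identify ℓ m i p) ≡ embed (identify ℓ m i q) →
                  identify ℓ m i p ≡ identify ℓ m i q
      sameLeg-≡ i p q e = cong (identify ℓ m i) (leg.injective i p q
        (trans (sym (embed-identify i p)) (trans e (embed-identify i q))))

      inPart : ∀ i p → p ≢ path zero → part i (embed (identify ℓ m i p))
      inPart i p ne = subst (part i) (sym (embed-identify i p)) (leg.to-rest i p ne)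

      ~⇒adj : ∀ u v → embed u ~ embed v → MultibroomAdj ℓ m u v
      ~⇒adj u v e with view u | view v
      ... | isRoot       | isRoot      = contradiction e (~-irr refl)
      ... | isRoot       | inLeg i q _ = sameLeg i (path zero) q e
      ... | inLeg i p _  | isRoot      = sameLeg i p (path zero) e
      ... | inLeg i p ne | inLeg j q ne′ with i ≟ j
      ...   | yes refl = sameLeg i p q e
      ...   | no  i≢j  = contradiction e (proj₁ (separate i≢j (inPart i p ne) (inPart j q ne′)))

      embed-injective : ∀ u v → embed u ≡ embed v → u ≡ v
      embed-injective u v e with view u | view v
      ... | isRoot       | isRoot      = refl
      ... | isRoot       | inLeg i q _ = sameLeg-≡ i (path zero) q e
      ... | inLeg i p _  | isRoot      = sameLeg-≡ i p (path zero) e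
      ... | inLeg i p ne | inLeg j q ne′ with i ≟ j
      ...   | yes refl = sameLeg-≡ i p q e
      ...   | no  i≢j  = contradiction e (proj₂ (separate i≢j (inPart i p ne) (inPart j q ne′)))

      multibroomCopy : InducedCopy (multibroom ℓ m) graph
      multibroomCopy = record
        { vertices = mk↣ {to = embed} (embed-injective _ _)
        ; edges = λ u v → mk⇔ adj⇒~ (~⇒adj u v) }

    multibroom-free⇒stable : multibroom ℓ m -free graph → ∀ k → complete (suc k) -free graph →
      ∀ w → HasStable (suc (Constants.excess n₀ (pred ∘ ℓ) m k)) w allVertices
    multibroom-free⇒stable free k noClique =
      stableBound (λ M → free (multibroomCopy (lengthen M))) k allVertices (cliqueFree k noClique)

-- Growth of powers.

-- The left side consists of the first two terms of the binomial expansion of the right side.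
bernoulli : ∀ E m → E ^ suc m + suc m * E ^ m ≤ suc E ^ suc m
bernoulli E zero    = ≤-reflexive (base E)
  where
  base : ∀ E → E * 1 + 1 ≡ (1 + E) * 1
  base = solve-∀
bernoulli E (suc m) = begin
  E * (E * p) + (2 + m) * (E * p)                  ≤⟨ m≤m+n _ _ ⟩
  E * (E * p) + (2 + m) * (E * p) + (1 + m) * p    ≡⟨ expand E m p ⟩
  suc E * (E * p + suc m * p)                      ≤⟨ *-monoʳ-≤ (suc E) (bernoulli E m) ⟩
  suc E * suc E ^ suc m                            ∎
  where
  open ≤-Reasoning
  p = E ^ m
  expand : ∀ E m p → E * (E * p) + (2 + m) * (E * p) + (1 + m) * p ≡ (1 + E) * (E * p + (1 + m) * p)
  expand = solve-∀

^-distribʳ-* : ∀ n x y → (x * y) ^ n ≡ x ^ n * y ^ n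
^-distribʳ-* zero    x y = refl
^-distribʳ-* (suc n) x y = trans (cong (x * y *_) (^-distribʳ-* n x y)) (interchange x y (x ^ n) (y ^ n))
  where
  interchange : ∀ x y p q → x * y * (p * q) ≡ x * p * (y * q)
  interchange = solve-∀

-- `(1 + 1/E) ^ (E + 1)` is at least 2 by `bernoulli`; this is its `q`-th power with denominators
-- cleared.
doubling : ∀ E q → 2 ^ q * E ^ (suc E * q) ≤ suc E ^ (suc E * q)
doubling E q = begin
  2 ^ q * E ^ (suc E * q)      ≡⟨ cong ((2 ^ q) *_) (^-*-assoc E (suc E) q) ⟨
  2 ^ q * (E ^ suc E) ^ q      ≡⟨ ^-distribʳ-* q 2 (E ^ suc E) ⟨
  (2 * E ^ suc E) ^ q          ≤⟨ ^-monoˡ-≤ q twice ⟩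
  (suc E ^ suc E) ^ q          ≡⟨ ^-*-assoc (suc E) (suc E) q ⟩
  suc E ^ (suc E * q)          ∎
  where
  open ≤-Reasoning
  twice : 2 * E ^ suc E ≤ suc E ^ suc E
  twice = begin
    2 * (E * E ^ E)                    ≡⟨ cong (λ z → E * E ^ E + z) (+-identityʳ _) ⟩
    E * E ^ E + E * E ^ E              ≤⟨ +-monoʳ-≤ (E * E ^ E) (*-monoˡ-≤ (E ^ E) (n≤1+n E)) ⟩
    E * E ^ E + suc E * E ^ E          ≤⟨ bernoulli E E ⟩
    suc E ^ suc E                      ∎

n<2^n : ∀ n → n < 2 ^ n
n<2^n zero    = s≤s z≤n
n<2^n (suc n) = ≤-trans (+-mono-≤ (s≤s z≤n) (n<2^n n))
  (≤-trans (+-monoˡ-≤ (2 ^ n) (≤-trans (s≤s z≤n) (n<2^n n))) (≤-reflexive (cong (λ z → 2 ^ n + z) (sym (+-identityʳ _)))))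

-- Fractional colourings by multiplicative weights.

module _ (G : FiniteGraph) (C₀ : ℕ) where
  open InGraph G

  private
    -- `E / C` equals `2 - 1/C`: everything doubles in a round except a stable set with at least a
    -- `1/C` share of the weight.
    C E : ℕ
    C = suc C₀
    E = suc (2 * C₀)

    all : DecSet V
    all = allVertices G

  toSubset : DecSet V → Subset order
  toSubset S = Vec.tabulate λ v → does (mem? S v)

  ∈-toSubset : ∀ S {v} → v Subset.∈ toSubset S → v ∈ S
  ∈-toSubset S {v} v∈ with mem? S v | trans (sym (lookup∘tabulate (λ v → does (mem? S v)) v)) ([]=⇒lookup v∈)
  ... | yes p | _ = p

  coverage : ∀ {r} → (Fin r → Subset order) → V → ℕ
  coverage A v = ∣ Vec.tabulate (λ i → lookup (A i) v) ∣

  module Rounds (stable : ∀ w → HasStable C w all) where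

    -- In each round the vertices missed by the chosen stable set double their weight, so that
    -- a vertex covered rarely would end up heavier than the total weight allows.
    record Outcome (r : ℕ) (w : V → ℕ) : Set where
      field
        A         : Fin r → Subset order
        A-stable  : ∀ i → Stable graph (A i)
        final     : V → ℕ
        balance   : ∀ v → final v * 2 ^ coverage A v ≡ 2 ^ r * w v
        decay     : C ^ r * wt final all ≤ E ^ r * wt w all

    play : ∀ r w → Outcome r w
    play zero    w = record
      { A = λ () ; A-stable = λ () ; final = w
      ; balance = λ v → trans (*-identityʳ _) (sym (*-identityˡ _)) ; decay = ≤-refl }
    play (suc r) w = record
      { A = A′ ; A-stable = A′-stable ; final = O.final ; balance = balance′ ; decay = decay′ }
      where
      S : DecSet V
      S = proj₁ (stable w)
      w′ : V → ℕ
      w′ v with mem? S v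
      ... | yes _ = w v
      ... | no  _ = 2 * w v
      module O = Outcome (play r w′)
      A′ : Fin (suc r) → Subset order
      A′ zero    = toSubset S
      A′ (suc i) = O.A i
      A′-stable : ∀ i → Stable graph (A′ i)
      A′-stable zero    u∈ v∈ = proj₁ (proj₂ (proj₂ (stable w))) (∈-toSubset S u∈) (∈-toSubset S v∈)
      A′-stable (suc i) = O.A-stable i

      balance′ : ∀ v → O.final v * 2 ^ coverage A′ v ≡ 2 ^ suc r * w v
      balance′ v rewrite lookup∘tabulate (λ v → does (mem? S v)) v with mem? S v | O.balance v
      ... | yes _ | eq = trans (swap₁ (O.final v) (2 ^ coverage O.A v))
                           (trans (cong (2 *_) eq) (sym (*-assoc 2 (2 ^ r) (w v))))
        where
        swap₁ : ∀ x y → x * (2 * y) ≡ 2 * (x * y)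
        swap₁ = solve-∀
      ... | no  _ | eq = trans eq (swap₂ (2 ^ r) (w v))
        where
        swap₂ : ∀ x y → x * (2 * y) ≡ 2 * x * y
        swap₂ = solve-∀

      open ≤-Reasoning

      gain : wt w′ all + wt w S ≤ 2 * wt w all
      gain = begin
        wt w′ all + wt w S                       ≤⟨ +-monoˡ-≤ (wt w S) (wt-cover w′ {all} {S} {all ∖ S} λ {v} _ → case mem? S v of λ { (yes p) → inj₁ p ; (no ¬p) → inj₂ (refl , ¬p) }) ⟩
        wt w′ S + wt w′ (all ∖ S) + wt w S       ≤⟨ +-monoˡ-≤ (wt w S) (+-mono-≤ (wt-mono inside) (wt-mono outside)) ⟩
        wt w S + wt (λ v → 2 * w v) (all ∖ S) + wt w S   ≡⟨ cong (λ z → wt w S + z + wt w S) (wt-scale w 2 (all ∖ S)) ⟩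
        wt w S + 2 * wt w (all ∖ S) + wt w S     ≡⟨ collect (wt w S) (wt w (all ∖ S)) ⟩
        2 * (wt w S + wt w (all ∖ S))            ≤⟨ *-monoʳ-≤ 2 (wt-disjoint w {all} {S} {all ∖ S} (λ _ → refl) (λ _ → refl) λ p (_ , ¬p) → ¬p p) ⟩
        2 * wt w all                             ∎
        where
        collect : ∀ x y → x + 2 * y + x ≡ 2 * (x + y)
        collect = solve-∀
        inside : ∀ {v} → v ∈ S → v ∈ S × w′ v ≤ w v
        inside {v} v∈S with mem? S v
        ... | yes _ = v∈S , ≤-refl
        ... | no ¬p = contradiction v∈S ¬p
        outside : ∀ {v} → v ∈ all ∖ S → v ∈ all ∖ S × w′ v ≤ 2 * w v
        outside {v} v∈ with mem? S v
        ... | yes p = contradiction p (proj₂ v∈)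
        ... | no  _ = v∈ , ≤-refl

      shrink : C * wt w′ all ≤ E * wt w all
      shrink = +-cancelʳ-≤ (wt w all) _ _ (begin
        C * wt w′ all + wt w all             ≤⟨ +-monoʳ-≤ (C * wt w′ all) (proj₂ (proj₂ (proj₂ (stable w)))) ⟩
        C * wt w′ all + C * wt w S           ≡⟨ *-distribˡ-+ C (wt w′ all) (wt w S) ⟨
        C * (wt w′ all + wt w S)             ≤⟨ *-monoʳ-≤ C gain ⟩
        C * (2 * wt w all)                   ≡⟨ collect C₀ (wt w all) ⟩
        E * wt w all + wt w all              ∎)
        where
        collect : ∀ c x → (1 + c) * (2 * x) ≡ (1 + 2 * c) * x + x
        collect = solve-∀

      decay′ : C ^ suc r * wt O.final all ≤ E ^ suc r * wt w all
      decay′ = begin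
        C * C ^ r * wt O.final all      ≡⟨ *-assoc C (C ^ r) _ ⟩
        C * (C ^ r * wt O.final all)    ≤⟨ *-monoʳ-≤ C O.decay ⟩
        C * (E ^ r * wt w′ all)         ≡⟨ swap C (E ^ r) (wt w′ all) ⟩
        E ^ r * (C * wt w′ all)         ≤⟨ *-monoʳ-≤ (E ^ r) shrink ⟩
        E ^ r * (E * wt w all)          ≡⟨ swap′ (E ^ r) E (wt w all) ⟩
        E * E ^ r * wt w all            ∎
        where
        swap : ∀ x y z → x * (y * z) ≡ y * (x * z)
        swap = solve-∀
        swap′ : ∀ x y z → x * (y * z) ≡ y * x * z
        swap′ = solve-∀

    -- Since `suc E` is `2 * C`, there are `4 * C * b` rounds, which gives the ratio `4 * C`. Their
    -- number fits `doubling` with exponent `2 * b`, and `b` exceeds the logarithm of the initial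
    -- total weight.
    b rounds : ℕ
    b      = suc order
    rounds = suc E * (b + b)

    open Outcome (play rounds (λ _ → 1))

    -- The final weight of `v` is at most the final total. With `balance`, `decay` and `doubling`
    -- this bounds `2 * b` by `order + coverage A v`, and `order` is less than `b`.
    covered : ∀ v → b ≤ coverage A v
    covered v = +-cancelˡ-≤ b _ _ (≤-trans (≮⇒≥ λ lt → <⇒≱ (^-monoʳ-< 2 (s≤s (s≤s z≤n)) lt) bound)
                                    (+-monoˡ-≤ (coverage A v) (n≤1+n order)))
      where
      open ≤-Reasoning
      instance
        E^r≢0 : NonZero (E ^ rounds)
        E^r≢0 = m^n≢0 E rounds
      bound : 2 ^ (b + b) ≤ 2 ^ (order + coverage A v)
      bound = *-cancelʳ-≤ _ _ (E ^ rounds) (begin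
        2 ^ (b + b) * E ^ rounds
          ≤⟨ doubling E (b + b) ⟩
        suc E ^ rounds
          ≡⟨ cong (_^ rounds) (double C₀) ⟩
        (C * 2) ^ rounds
          ≡⟨ ^-distribʳ-* rounds C 2 ⟩
        C ^ rounds * 2 ^ rounds
          ≡⟨ cong ((C ^ rounds) *_) (trans (sym (*-identityʳ (2 ^ rounds))) (sym (balance v))) ⟩
        C ^ rounds * (final v * 2 ^ coverage A v)
          ≤⟨ *-monoʳ-≤ (C ^ rounds) (*-monoˡ-≤ (2 ^ coverage A v) (w≤wt final {all} {v} refl)) ⟩
        C ^ rounds * (wt final all * 2 ^ coverage A v)
          ≡⟨ *-assoc (C ^ rounds) (wt final all) _ ⟨
        C ^ rounds * wt final all * 2 ^ coverage A v
          ≤⟨ *-monoˡ-≤ (2 ^ coverage A v) decay ⟩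
        E ^ rounds * size all * 2 ^ coverage A v
          ≤⟨ *-monoˡ-≤ (2 ^ coverage A v) (*-monoʳ-≤ (E ^ rounds) (≤-trans (size≤ all) (<⇒≤ (n<2^n order)))) ⟩
        E ^ rounds * 2 ^ order * 2 ^ coverage A v
          ≡⟨ trans (*-assoc (E ^ rounds) (2 ^ order) _) (trans (cong ((E ^ rounds) *_) (sym (^-distribˡ-+-* 2 order (coverage A v)))) (*-comm (E ^ rounds) _)) ⟩
        2 ^ (order + coverage A v) * E ^ rounds ∎)
        where
        double : ∀ c → 2 + 2 * c ≡ (1 + c) * 2
        double = solve-∀

    colouring : FractionalColouring G rounds b
    colouring = record { A = A ; stable = A-stable ; covers = covered }

    ratio : + rounds ℚ./ b ≡ + (4 * C) ℚ./ 1
    -- `mkℚᵘ` takes the denominator minus one, so `order` encodes the denominator `b`.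
    ratio = fromℚᵘ-cong {mkℚᵘ (+ rounds) order} {mkℚᵘ (+ (4 * C)) 0} (*≡* (trans (sym (pos-* rounds 1))
      (trans (cong +_ (count C₀ b)) (pos-* (4 * C) b))))
      where
      count : ∀ c b → (2 + 2 * c) * (b + b) * 1 ≡ 4 * (1 + c) * b
      count = solve-∀

    colourable : FractionallyColourableAt G (+ (4 * C) ℚ./ 1)
    colourable = record
      { a = rounds ; b = b ; a-nonZero = _ ; b-nonZero = _ ; colouring = colouring ; ratio = sym ratio }

1<4C : ∀ c → 1ℚ ℚ.< + (4 * suc c) ℚ./ 1
1<4C c = toℚᵘ-cancel-< (<-respʳ-≃ (≃-sym (toℚᵘ-fromℚᵘ (mkℚᵘ (+ (4 * suc c)) 0)))
  (*<* (+<+ (≤-trans (s≤s (s≤s z≤n)) (≤-trans (*-monoʳ-≤ 4 (s≤s (z≤n {c}))) (≤-reflexive (sym (*-identityʳ _))))))))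

mainTheorem4 : (T : FiniteGraph) → IsMultibroom (FiniteGraph.graph T) →
    (k : ℕ) → 1 ≤ k →
    ∃[ c ] (1ℚ ℚ.< c ×
    ((G : FiniteGraph) →
    FiniteGraph.graph T -free FiniteGraph.graph G →
    complete (suc k) -free FiniteGraph.graph G →
    (q : ℚ) → IsFractionalChromaticNumber G q → q ℚ.≤ c))
-- The ratio `4 * suc C₀` is attained by a fractional colouring, and `q` is at most every attained
-- ratio.
mainTheorem4 T (suc n₀ , ℓ , m , _ , ℓ≥1 , T≅) k _ = + (4 * suc C₀) ℚ./ 1 , 1<4C C₀ , λ G T-free K-free q (_ , least) →
    least _ (Rounds.colourable G C₀ (multibroom-free⇒stable G ℓ m ℓ≥1 (λ copy → T-free (≅-copy T≅ copy)) k K-free))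
  where
  C₀ = Constants.excess n₀ (λ i → pred (ℓ i)) m k
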